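{- Let $k\ge 1$ be an integer, let $G$ be a connected triangle-free graph on $n$ vertices, and let $v\in V(G)$. If $G$ contains no induced subgraph that is a tree on $k+1$ vertices containing $v$, then $n\le 1+\frac{(k-1)k}{2}$. Further, equality holds only if $G$ is isomorphic to $G_k$ via an isomorphism mapping $v$ to $v_0$.
   Context: All graphs are finite and simple. For $k\ge 1$, $G_k$ is the bipartite graph obtained from the path $v_0v_1\ldots v_{k-1}$ by replacing each $v_i$ ($1\le i\le k-1$) by $k-i$ independent vertices, while $v_0$ remains a single vertex. Explicitly, $V(G_k)=\{v_0\}\cup V_1\cup\dots\cup V_{k-1}$ where the $V_i$ are pairwise disjoint independent sets with $|V_i|=k-i$; $v_0$ is adjacent to every vertex of $V_1$, every vertex of $V_i$ is adjacent to every vertex of $V_{i+1}$ for $1\le i\le k-2$, and there are no other edges. Thus $|G_k|=1+\frac{(k-1)k}{2}$. An induced tree through $v$ means an induced subgraph of $G$ that is a tree and contains the vertex $v$. -}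

module Defs where

open import Data.Nat using (ℕ; zero; suc; _∸_; _≤_; s≤s; z≤n)
open import Data.Fin using (Fin; zero; suc; toℕ; inject₁; fromℕ)
open import Data.Bool using (Bool; true; false)
open import Data.Product using (Σ; ∃; _×_; _,_)
open import Relation.Binary.PropositionalEquality using (_≡_)
open import Relation.Nullary using (¬_)
open import Function.Definitions using (Injective)
open import Function.Bundles using (_↔_; Inverse)
open import Data.Sum using (_⊎_)

record Graph (n : ℕ) : Set where
  field
    adj    : Fin n → Fin n → Bool
    sym    : ∀ x y → adj x y ≡ adj y x
    irrefl : ∀ x → adj x x ≡ false
open Graph public

Edge : ∀ {n} → Graph n → Fin n → Fin n → Set
Edge G x y = adj G x y ≡ true

data Reach {n : ℕ} (G : Graph n) : Fin n → Fin n → Set where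
  here : ∀ {x} → Reach G x x
  step : ∀ {x y z} → Edge G x y → Reach G y z → Reach G x z

Connected : ∀ {n} → Graph n → Set
Connected {n} G = ∀ (x y : Fin n) → Reach G x y

HasCycle : ∀ {n} → Graph n → Set
HasCycle {n} G =
  Σ ℕ λ l → Σ (Fin (suc (suc (suc l))) → Fin n) λ c →
    Injective _≡_ _≡_ c
    × (∀ (i : Fin (suc (suc l))) → Edge G (c (inject₁ i)) (c (suc i)))
    × Edge G (c (fromℕ (suc (suc l)))) (c zero)

IsTree : ∀ {n} → Graph n → Set
IsTree G = Connected G × ¬ HasCycle G

TriangleFree : ∀ {n} → Graph n → Set
TriangleFree {n} G =
  ¬ (Σ (Fin n) λ x → Σ (Fin n) λ y → Σ (Fin n) λ z →
       Edge G x y × Edge G y z × Edge G x z)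

induced : ∀ {n m} → Graph n → (Fin m → Fin n) → Graph m
induced G g = record
  { adj    = λ i j → adj G (g i) (g j)
  ; sym    = λ i j → sym G (g i) (g j)
  ; irrefl = λ i → irrefl G (g i)
  }

HasInducedTreeThrough : ∀ {n} → Graph n → Fin n → ℕ → Set
HasInducedTreeThrough {n} G v m =
  Σ (Fin m → Fin n) λ g →
    Injective _≡_ _≡_ g × (∃ λ i → g i ≡ v) × IsTree (induced G g)

layerSize : (k : ℕ) → Fin k → ℕ
layerSize k zero    = 1
layerSize k (suc i) = k ∸ toℕ (suc i)

GkV : ℕ → Set
GkV k = Σ (Fin k) λ i → Fin (layerSize k i)

GkAdj : ∀ {k} → GkV k → GkV k → Set
GkAdj (i , _) (j , _) = (toℕ j ≡ suc (toℕ i)) ⊎ (toℕ i ≡ suc (toℕ j))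

v₀ : ∀ k → 1 ≤ k → GkV k
v₀ (suc k) _ = zero , zero

IsoToGk : ∀ {n} → Graph n → Fin n → (k : ℕ) → 1 ≤ k → Set
IsoToGk {n} G v k k≥1 =
  Σ (Fin n ↔ GkV k) λ f →
    (∀ x y → (Edge G x y → GkAdj (Inverse.to f x) (Inverse.to f y))
           × (GkAdj (Inverse.to f x) (Inverse.to f y) → Edge G x y))
    × Inverse.to f v ≡ v₀ k k≥1

{-# OPTIONS --safe #-}

-- Put a = k ∸ 1, let N be the neighbours of v, and for each component C of G − v − N let x C be the
-- least x with |C| ≤ x (x + 1) / 2. By induction, for every u ∈ N with a neighbour in C there is a
-- tree through u with x C further vertices in C. Gluing such trees along a star at v shows that for
-- every S ⊆ N and every family of components each touched by exactly one element of S,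
-- |S| + (sum of x over the family) ≤ a. With S = N this gives |N| ≤ a, and with S = {u} that the
-- components touched by u have total weight at most a − 1.
--
-- It remains to bound the sum of x C (x C + 1). Take a minimal multiset zs of neighbours touching
-- each C at least x C + 1 times. Every element of zs touches a tight component (one touched exactly
-- x C + 1 times). In a minimal family F of tight components covering zs each member has a private
-- element of zs, so |zs| ≤ Σ_F (x C + 1) ≤ a. Double counting now gives
-- Σ x C (x C + 1) ≤ Σ_{u ∈ zs} (weight touched by u) ≤ a (a − 1).
--
-- In case of equality a family F with more than one member can always be replaced by a smaller one;
-- hence there is a single component C with x C = a − 1. By induction C ∪ {u} is layered for every
-- u ∈ N, and the first layers agree for all u, as otherwise there is a tree on a + 2 vertices.
module Submission where

open import Defs
open import Data.Nat using (ℕ; zero; suc; _+_; _*_; _∸_; _/_; _≤_; _<_; _≤?_; z≤n; s≤s; s≤s⁻¹; NonZero; >-nonZero)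
open import Data.Nat.DivMod using (m*n/n≡m)
open import Data.Nat.ListAction using (sum)
open import Data.Nat.ListAction.Properties using (sum-++)
open import Data.Nat.Properties renaming (_≟_ to _≟ℕ_)
open import Data.Nat.Solver using (module +-*-Solver)
open import Data.Fin as Fin using (Fin; zero; suc; toℕ; inject₁; fromℕ)
import Data.Fin.Properties as Fin
open import Data.Fin.Properties using (_≟_)
open import Data.Fin.Relation.Unary.Top using (View; view; ‵fromℕ; ‵inj₁)
open import Data.Bool using (Bool; true; false)
import Data.Bool.Properties as Bool
open import Data.Product using (∃; _×_; _,_; proj₁; proj₂)
open import Data.Sum using (_⊎_; inj₁; inj₂; [_,_]′) renaming (map to map⊎; swap to swap⊎)
open import Data.Empty using (⊥-elim)
open import Data.List using (List; []; _∷_; _++_; length; map; filter; replicate; concat; lookup; allFin)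
open import Data.List.Properties
  using (map-++; ++-identityʳ; ++-assoc; length-++; concat-++; partition-defn; filter-notAll; ≡-dec; length-tabulate)
open import Data.List.Membership.Propositional using (_∈_; _∉_; find; lose)
open import Data.List.Membership.Propositional.Properties
  using (∈-filter⁺; ∈-filter⁻; ∈-AllPairs₂; ∈-++⁻; ∈-++⁺ˡ; ∈-++⁺ʳ; ∈-concat⁻′; ∈-concat⁺′; ∈-length; ∈-lookup; ∈-allFin)
import Data.List.Membership.DecPropositional as DecMembership
open import Data.List.Relation.Unary.Any using (Any; here; there; any?; index)
open import Data.List.Relation.Unary.Any.Properties using (lookup-index)
open import Data.List.Relation.Unary.All as All using (All; []; _∷_; all?)
open import Data.List.Relation.Unary.All.Properties using (¬All⇒Any¬)
open import Data.List.Relation.Unary.AllPairs using (AllPairs; []; _∷_)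
import Data.List.Relation.Unary.AllPairs.Properties as AllPairs
open import Data.List.Relation.Unary.Unique.Propositional using (Unique)
import Data.List.Relation.Unary.Unique.Propositional.Properties as Unique
open import Data.List.Relation.Binary.Permutation.Propositional
open import Data.List.Relation.Binary.Permutation.Propositional.Properties
  using (∈-resp-↭; ↭-length; ++⁺ˡ; shifts)
import Data.List.Relation.Binary.Permutation.Setoid.Properties as PermSetoid
open import Data.List.Relation.Binary.Sublist.Propositional as Sublist
  using ([]; _∷_; _∷ʳ_) renaming (_⊆_ to _⊑_)
import Data.List.Relation.Binary.Sublist.Propositional.Properties as Sublist
import Data.List.Relation.Binary.Sublist.Heterogeneous.Properties as HeteroSublist
open import Function using (_∘_; flip; case_of_)
open import Function.Bundles using (mk⇔; mk⤖; _↔_; Inverse)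
open import Function.Definitions using (Injective)
open import Function.Properties.Bijection using (⤖⇒↔)
open import Function.Properties.Inverse using (↔-sym)
open import Relation.Nullary using (¬_; Dec; yes; no; does)
open import Relation.Nullary.Decidable using (¬?; _×-dec_; _→-dec_; decidable-stable; dec-true; dec-false; does-⇔)
open import Relation.Unary using (Decidable)
open import Relation.Unary.Properties using (∁?)
open import Relation.Binary using (DecidableEquality)
open import Relation.Binary.PropositionalEquality as ≡
  using (_≡_; _≢_; refl; cong; cong₂; subst; subst₂; module ≡-Reasoning)

private variable
  A B : Set

-- Finite sums over lists.

∑ : (A → ℕ) → List A → ℕ
∑ f xs = sum (map f xs)

∑-++ : ∀ (f : A → ℕ) xs ys → ∑ f (xs ++ ys) ≡ ∑ f xs + ∑ f ys
∑-++ f xs ys = ≡.trans (cong sum (map-++ f xs ys)) (sum-++ (map f xs) (map f ys))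

∑-mono : ∀ {f g : A → ℕ} xs → (∀ {a} → a ∈ xs → f a ≤ g a) → ∑ f xs ≤ ∑ g xs
∑-mono []       f≤g = z≤n
∑-mono (a ∷ xs) f≤g = +-mono-≤ (f≤g (here refl)) (∑-mono xs (f≤g ∘ there))

∑-cong : ∀ {f g : A → ℕ} xs → (∀ {a} → a ∈ xs → f a ≡ g a) → ∑ f xs ≡ ∑ g xs
∑-cong []       f≡g = refl
∑-cong (a ∷ xs) f≡g = cong₂ _+_ (f≡g (here refl)) (∑-cong xs (f≡g ∘ there))

+-tight : ∀ {a b c d} → a ≤ b → c ≤ d → b + d ≤ a + c → a ≡ b × c ≡ d
+-tight {a} {b} {c} {d} a≤b c≤d b+d≤a+c =
    ≤-antisym a≤b (+-cancelʳ-≤ c b a (≤-trans (+-monoʳ-≤ b c≤d) b+d≤a+c))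
  , ≤-antisym c≤d (+-cancelˡ-≤ a d c (≤-trans (+-monoˡ-≤ d a≤b) b+d≤a+c))

-- How the equality cases of the counting are read off: once a chain of termwise estimates closes
-- up, no single term can be strict.
∑-tight : ∀ {f g : A → ℕ} xs → (∀ {a} → a ∈ xs → f a ≤ g a) → ∑ g xs ≤ ∑ f xs →
          ∀ {a} → a ∈ xs → f a ≡ g a
∑-tight (a ∷ xs) f≤g ∑g≤∑f =
  let heads , tails = +-tight (f≤g (here refl)) (∑-mono xs (f≤g ∘ there)) ∑g≤∑f
  in λ { (here refl) → heads ; (there a∈) → ∑-tight xs (f≤g ∘ there) (≤-reflexive (≡.sym tails)) a∈ }

∑-zero : ∀ (xs : List A) → ∑ (λ _ → 0) xs ≡ 0
∑-zero []       = refl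
∑-zero (_ ∷ xs) = ∑-zero xs

∑-const : ∀ c (xs : List A) → ∑ (λ _ → c) xs ≡ length xs * c
∑-const c []       = refl
∑-const c (_ ∷ xs) = cong (c +_) (∑-const c xs)

∑-+ : ∀ (f g : A → ℕ) xs → ∑ (λ a → f a + g a) xs ≡ ∑ f xs + ∑ g xs
∑-+ f g []       = refl
∑-+ f g (a ∷ xs) = begin
  f a + g a + ∑ (λ a → f a + g a) xs  ≡⟨ cong (f a + g a +_) (∑-+ f g xs) ⟩
  f a + g a + (∑ f xs + ∑ g xs)       ≡⟨ +-assoc (f a) (g a) _ ⟩
  f a + (g a + (∑ f xs + ∑ g xs))     ≡⟨ cong (f a +_) (+-comm (g a) _) ⟩
  f a + (∑ f xs + ∑ g xs + g a)       ≡⟨ cong (f a +_) (+-assoc (∑ f xs) _ _) ⟩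
  f a + (∑ f xs + (∑ g xs + g a))     ≡⟨ cong (λ t → f a + (∑ f xs + t)) (+-comm _ (g a)) ⟩
  f a + (∑ f xs + (g a + ∑ g xs))     ≡⟨ +-assoc (f a) _ _ ⟨
  f a + ∑ f xs + (g a + ∑ g xs)       ∎
  where open ≡-Reasoning

∑-swap : ∀ (f : A → B → ℕ) xs ys →
         ∑ (λ a → ∑ (f a) ys) xs ≡ ∑ (λ b → ∑ (λ a → f a b) xs) ys
∑-swap f []       ys = ≡.sym (∑-zero ys)
∑-swap f (a ∷ xs) ys = ≡.trans (cong (∑ (f a) ys +_) (∑-swap f xs ys))
                               (≡.sym (∑-+ (f a) (λ b → ∑ (λ a → f a b) xs) ys))

∑-*ˡ : ∀ c (f : A → ℕ) xs → ∑ (λ a → c * f a) xs ≡ c * ∑ f xs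
∑-*ˡ c f []       = ≡.sym (*-zeroʳ c)
∑-*ˡ c f (a ∷ xs) = ≡.trans (cong (c * f a +_) (∑-*ˡ c f xs)) (≡.sym (*-distribˡ-+ c (f a) _))

∑-suc : ∀ (f : A → ℕ) xs → ∑ (suc ∘ f) xs ≡ length xs + ∑ f xs
∑-suc f xs = ≡.trans (∑-+ (λ _ → 1) f xs)
                     (cong (_+ ∑ f xs) (≡.trans (∑-const 1 xs) (*-identityʳ _)))

∑-⊑ : ∀ (f : A → ℕ) {xs ys} → xs ⊑ ys → ∑ f xs ≤ ∑ f ys
∑-⊑ f []           = z≤n
∑-⊑ f (a ∷ʳ s)     = m≤n⇒m≤o+n (f a) (∑-⊑ f s)
∑-⊑ f (refl ∷ s)   = +-monoʳ-≤ (f _) (∑-⊑ f s)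

Unique-⊑ : ∀ {xs ys : List A} → xs ⊑ ys → Unique ys → Unique xs
Unique-⊑ []         []         = []
Unique-⊑ (_ ∷ʳ s)   (_ ∷ ys!)  = Unique-⊑ s ys!
Unique-⊑ (refl ∷ s) (a∉ ∷ ys!) = Sublist.All-resp-⊆ s a∉ ∷ Unique-⊑ s ys!

∑-member : ∀ (f : A → ℕ) {xs a} → a ∈ xs → f a ≤ ∑ f xs
∑-member f (here refl)    = m≤m+n _ _
∑-member f (there {x} a∈) = m≤n⇒m≤o+n (f x) (∑-member f a∈)

∑-pair : ∀ (f : A → ℕ) {xs a c} → a ∈ xs → c ∈ xs → a ≢ c → f a + f c ≤ ∑ f xs
∑-pair f (here refl) (here refl) a≢c = ⊥-elim (a≢c refl)
∑-pair f (here refl) (there c∈)  a≢c = +-monoʳ-≤ (f _) (∑-member f c∈)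
∑-pair f {a = a} {c} (there a∈) (here refl) a≢c =
  ≤-trans (≤-reflexive (+-comm (f a) (f c))) (+-monoʳ-≤ (f c) (∑-member f a∈))
∑-pair f (there {x} a∈) (there c∈) a≢c = m≤n⇒m≤o+n (f x) (∑-pair f a∈ c∈ a≢c)

∑-single : ∀ (f : A → ℕ) {c xs} → Unique xs → (∀ {a} → a ∈ xs → f a ≡ 0 ⊎ a ≡ c) → ∑ f xs ≤ f c
∑-single f []         _ = z≤n
∑-single f {c} {a ∷ xs} (a∉ ∷ xs!) only with only (here refl)
... | inj₁ fa≡0 rewrite fa≡0 = ∑-single f xs! (only ∘ there)
... | inj₂ refl = ≤-reflexive (≡.trans (cong (f c +_) rest≡0) (+-identityʳ (f c)))
  where
  rest≡0 : ∑ f xs ≡ 0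
  rest≡0 = ≡.trans (∑-cong xs (λ a∈ → [ (λ e → e) , (λ a≡c → ⊥-elim (All.lookup a∉ a∈ (≡.sym a≡c))) ]′ (only (there a∈))))
                   (∑-zero xs)

-- The measure for the exchange in `smaller`, where one edge enters a family and at least two leave.
filter-drops-two : ∀ {P : A → Set} (P? : Decidable P) {xs a c} → a ∈ xs → c ∈ xs → a ≢ c →
                   ¬ P a → ¬ P c → 2 + length (filter P? xs) ≤ length xs
filter-drops-two P? (here refl) (here refl) a≢c _ _ = ⊥-elim (a≢c refl)
filter-drops-two P? {x ∷ xs} (here refl) (there c∈) _ ¬a ¬c with P? x
... | yes a = ⊥-elim (¬a a)
... | no _  = s≤s (filter-notAll P? xs (lose c∈ ¬c))
filter-drops-two P? {x ∷ xs} (there a∈) (here refl) _ ¬a ¬c with P? x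
... | yes c = ⊥-elim (¬c c)
... | no _  = s≤s (filter-notAll P? xs (lose a∈ ¬a))
filter-drops-two P? {x ∷ xs} (there a∈) (there c∈) a≢c ¬a ¬c with P? x
... | yes _ = s≤s (filter-drops-two P? a∈ c∈ a≢c ¬a ¬c)
... | no _  = m≤n⇒m≤1+n (filter-drops-two P? a∈ c∈ a≢c ¬a ¬c)

-- Lists without repetitions, permutations and concatenations.

Unique-const⇒singleton : ∀ {c : A} {xs} → Unique xs → c ∈ xs → (∀ {a} → a ∈ xs → a ≡ c) → xs ≡ c ∷ []
Unique-const⇒singleton {xs = a ∷ []}    _ _ all≡ = cong (_∷ []) (all≡ (here refl))
Unique-const⇒singleton {xs = a ∷ d ∷ _} ((a≢d ∷ _) ∷ _) _ all≡ =
  ⊥-elim (a≢d (≡.trans (all≡ (here refl)) (≡.sym (all≡ (there (here refl))))))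

filter-↭-partition : ∀ {P : A → Set} (P? : Decidable P) xs → xs ↭ filter P? xs ++ filter (∁? P?) xs
filter-↭-partition {A} P? xs =
  subst (λ (ys , zs) → xs ↭ ys ++ zs) (partition-defn P? xs)
        (↭ₛ⇒↭ (PermSetoid.partition-↭ (≡.setoid A) P? xs))

Unique-resp-↭ : ∀ {xs ys : List A} → xs ↭ ys → Unique xs → Unique ys
Unique-resp-↭ {A} p = PermSetoid.Unique-resp-↭ (≡.setoid A) (↭⇒↭ₛ p)

concat-↭ : ∀ {xss yss : List (List A)} → xss ↭ yss → concat xss ↭ concat yss
concat-↭ refl            = refl
concat-↭ (prep xs p)     = ++⁺ˡ xs (concat-↭ p)
concat-↭ (swap xs ys p)  = trans (shifts xs ys) (++⁺ˡ ys (++⁺ˡ xs (concat-↭ p)))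
concat-↭ (trans p q)     = trans (concat-↭ p) (concat-↭ q)

length-concat : ∀ (xss : List (List A)) → length (concat xss) ≡ ∑ length xss
length-concat []         = refl
length-concat (xs ∷ xss) = ≡.trans (length-++ xs) (cong (length xs +_) (length-concat xss))

∈⇒⊑-concat : ∀ {xs : List A} {xss} → xs ∈ xss → xs ⊑ concat xss
∈⇒⊑-concat {xs = xs} (here {xs = xss} refl) = Sublist.++⁺ʳ (concat xss) Sublist.⊆-refl
∈⇒⊑-concat (there {x = ys} xs∈)  = Sublist.++⁺ˡ ys (∈⇒⊑-concat xs∈)

Unique-++⁻ˡ : ∀ (xs : List A) {ys} → Unique (xs ++ ys) → Unique xs
Unique-++⁻ˡ xs = Unique-⊑ (Sublist.++⁺ʳ _ Sublist.⊆-refl)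

Unique-++⁻ʳ : ∀ (xs : List A) {ys} → Unique (xs ++ ys) → Unique ys
Unique-++⁻ʳ xs = Unique-⊑ (Sublist.++⁺ˡ xs Sublist.⊆-refl)

Unique-++-disjoint : ∀ (xs : List A) {ys x} → Unique (xs ++ ys) → x ∈ xs → x ∉ ys
Unique-++-disjoint (x ∷ xs) (x∉ ∷ _)    (here refl) x∈ = All.lookup x∉ (∈-++⁺ʳ xs x∈) refl
Unique-++-disjoint (_ ∷ xs) (_ ∷ rest!) (there x∈)  = Unique-++-disjoint xs rest! x∈

lookup-injective : ∀ {xs : List A} → Unique xs → Injective _≡_ _≡_ (lookup xs)
lookup-injective (_ ∷ _)   {zero}  {zero}  _  = refl
lookup-injective (x∉ ∷ _)  {zero}  {suc j} eq = ⊥-elim (All.lookup x∉ (∈-lookup j) eq)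
lookup-injective (x∉ ∷ _)  {suc i} {zero}  eq = ⊥-elim (All.lookup x∉ (∈-lookup i) (≡.sym eq))
lookup-injective (_ ∷ xs!) {suc i} {suc j} eq = cong suc (lookup-injective xs! eq)

-- Multiset covers in a weighted hypergraph

⟦_⟧ : Bool → ℕ
⟦ true ⟧  = 1
⟦ false ⟧ = 0

∑-filter : ∀ (f : A → ℕ) (p : A → Bool) xs →
           ∑ f (filter (λ a → p a Bool.≟ true) xs) ≡ ∑ (λ a → f a * ⟦ p a ⟧) xs
∑-filter f p []       = refl
∑-filter f p (a ∷ xs) with p a
... | true  = cong₂ _+_ (≡.sym (*-identityʳ (f a))) (∑-filter f p xs)
... | false = ≡.trans (∑-filter f p xs) (cong (_+ ∑ (λ a → f a * ⟦ p a ⟧) xs) (≡.sym (*-zeroʳ (f a))))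

-- The incidence stays abstract because it is used in both directions: neighbours of `v` cover
-- components with demand `suc ∘ x`, and through `flip inc` components cover the elements of `zs`
-- with demand 1.
module Multicover {A B : Set} (inc : A → B → Bool) where

  count : B → List A → ℕ
  count b = ∑ (λ a → ⟦ inc a b ⟧)

  count⁺ : ∀ {a b xs} → a ∈ xs → inc a b ≡ true → 1 ≤ count b xs
  count⁺ {a} {b} (here refl) a∼b rewrite a∼b = s≤s z≤n
  count⁺ {b = b} (there {x} a∈) a∼b = m≤n⇒m≤o+n ⟦ inc x b ⟧ (count⁺ a∈ a∼b)

  count⁻ : ∀ {b} xs → 1 ≤ count b xs → ∃ λ a → a ∈ xs × inc a b ≡ true
  count⁻ {b} (a ∷ xs) 1≤ with inc a b in a∼b
  ... | true  = a , here refl , a∼b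
  ... | false = let a′ , a′∈ , a′∼b = count⁻ xs 1≤ in a′ , there a′∈ , a′∼b

  count≤1⇒≡ : ∀ {b} xs → count b xs ≤ 1 → ∀ {a a′} → a ∈ xs → a′ ∈ xs →
              inc a b ≡ true → inc a′ b ≡ true → a ≡ a′
  count≤1⇒≡ (_ ∷ xs) c≤1 (here refl) (here refl) _ _ = refl
  count≤1⇒≡ (_ ∷ xs) c≤1 (here refl) (there a′∈) a∼b a′∼b rewrite a∼b =
    ⊥-elim (<⇒≱ (count⁺ a′∈ a′∼b) (s≤s⁻¹ c≤1))
  count≤1⇒≡ (_ ∷ xs) c≤1 (there a∈) (here refl) a∼b a′∼b rewrite a′∼b =
    ⊥-elim (<⇒≱ (count⁺ a∈ a∼b) (s≤s⁻¹ c≤1))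
  count≤1⇒≡ {b} (x ∷ xs) c≤1 (there a∈) (there a′∈) =
    count≤1⇒≡ xs (≤-trans (m≤n+m _ ⟦ inc x b ⟧) c≤1) a∈ a′∈

  module _ (demand : B → ℕ) (bs : List B) where

    Covers : List A → Set
    Covers xs = All (λ b → demand b ≤ count b xs) bs

    -- In a cover the last inequality is an equality, so removing one copy of `a` would leave `b`
    -- short.
    Critical : List A → A → Set
    Critical xs a = ∃ λ b → b ∈ bs × inc a b ≡ true × count b xs ≤ demand b

    private
      count-shift : ∀ b xs a ys → count b (xs ++ a ∷ ys) ≡ count b (a ∷ xs ++ ys)
      count-shift b []       a ys = refl
      count-shift b (x ∷ xs) a ys = begin
        ⟦ inc x b ⟧ + count b (xs ++ a ∷ ys)            ≡⟨ cong (⟦ inc x b ⟧ +_) (count-shift b xs a ys) ⟩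
        ⟦ inc x b ⟧ + (⟦ inc a b ⟧ + count b (xs ++ ys)) ≡⟨ +-assoc ⟦ inc x b ⟧ _ _ ⟨
        ⟦ inc x b ⟧ + ⟦ inc a b ⟧ + count b (xs ++ ys)   ≡⟨ cong (_+ count b (xs ++ ys)) (+-comm ⟦ inc x b ⟧ _) ⟩
        ⟦ inc a b ⟧ + ⟦ inc x b ⟧ + count b (xs ++ ys)   ≡⟨ +-assoc ⟦ inc a b ⟧ _ _ ⟩
        ⟦ inc a b ⟧ + (⟦ inc x b ⟧ + count b (xs ++ ys)) ∎
        where open ≡-Reasoning

      -- One greedy pass: `kept` holds the elements already found indispensable, `xs` the undecided
      -- ones. An element goes if what remains still covers.
      prune′ : ∀ xs kept → Covers (xs ++ kept) →
               ∃ λ ys → ys ⊑ xs × Covers (ys ++ kept) × (∀ {a} → a ∈ ys → Critical (ys ++ kept) a)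
      prune′ []       kept cov = [] , [] , cov , λ ()
      prune′ (a ∷ xs) kept cov with all? (λ b → demand b ≤? count b (xs ++ kept)) bs
      ... | yes cov′ = let ys , ys⊑ , c , crit = prune′ xs kept cov′ in ys , a ∷ʳ ys⊑ , c , crit
      ... | no ¬cov with find (¬All⇒Any¬ (λ b → demand b ≤? count b (xs ++ kept)) bs ¬cov)
                       | prune′ xs (a ∷ kept)
                           (All.map (λ {b} → subst (demand b ≤_) (≡.sym (count-shift b xs a kept))) cov)
      ... | b , b∈ , d≰ | ys , ys⊑ , c , crit =
            a ∷ ys , refl ∷ ys⊑
          , All.map (λ {b} → subst (demand b ≤_) (count-shift b ys a kept)) c
          , λ { (here refl) → b , b∈ , a∼b , a-critical
              ; (there a∈) → let b′ , b′∈ , ∼b′ , ≤d = crit a∈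
                             in b′ , b′∈ , ∼b′ , subst (_≤ demand b′) (count-shift b′ ys a kept) ≤d }
        where
        a∼b : inc a b ≡ true
        a∼b with inc a b | All.lookup cov b∈
        ... | true  | _  = refl
        ... | false | d≤ = ⊥-elim (d≰ d≤)

        -- `b` was short without `a` when `xs` was still complete; later deletions only lower its
        -- count, so the shortage remains.
        a-critical : count b (a ∷ ys ++ kept) ≤ demand b
        a-critical rewrite a∼b = begin-strict
          count b (ys ++ kept)           ≡⟨ ∑-++ _ ys kept ⟩
          count b ys + count b kept      ≤⟨ +-monoˡ-≤ _ (∑-⊑ _ ys⊑) ⟩
          count b xs + count b kept      ≡⟨ ∑-++ _ xs kept ⟨
          count b (xs ++ kept)           <⟨ ≰⇒> d≰ ⟩
          demand b                       ∎
          where open ≤-Reasoning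

    prune : ∀ xs → Covers xs → ∃ λ ys → ys ⊑ xs × Covers ys × (∀ {a} → a ∈ ys → Critical ys a)
    prune xs cov with prune′ xs [] (subst Covers (≡.sym (++-identityʳ xs)) cov)
    ... | ys , ys⊑ , c , crit rewrite ++-identityʳ ys = ys , ys⊑ , c , crit

-- Weighted hypergraphs: the bound and its extremal case.

module Hypergraph {A B : Set} (inc : A → B → Bool) (N : List A) (Cs : List B) (x : B → ℕ) where

  -- The condition under which a tree inside `C` can be glued to a star with leaves `S` without
  -- closing a cycle.
  HitOnce : List A → B → Set
  HitOnce S C = ∃ λ u → u ∈ S × inc u C ≡ true × (∀ {w} → w ∈ S → inc w C ≡ true → w ≡ u)

  -- `suc b` is the bound a of the overview. Trees enter only through `weigh`; the rest is counting
  -- in the hypergraph with vertices `N` and edges `Cs`.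
  module Weighing (b : ℕ) (Cs! : Unique Cs)
    (x≥1 : ∀ {C} → C ∈ Cs → 1 ≤ x C)
    (hit : ∀ {C} → C ∈ Cs → ∃ λ u → u ∈ N × inc u C ≡ true)
    (weigh : ∀ S Gs → (∀ {u} → u ∈ S → u ∈ N) → Unique S → (∀ {C} → C ∈ Gs → C ∈ Cs) → Unique Gs →
             (∀ {C} → C ∈ Gs → HitOnce S C) → length S + ∑ x Gs ≤ suc b)
    where

    open Multicover inc
    open Multicover (flip inc) using () renaming
      (count to degree; count⁺ to degree⁺; count⁻ to degree⁻; count≤1⇒≡ to degree≤1⇒≡; prune to prune-family)

    load : A → ℕ
    load u = ∑ (λ C → x C * ⟦ inc u C ⟧) Cs

    -- The singleton `u` hits each of its edges exactly once, so `weigh` applies; `u` itself takes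
    -- one unit of `suc b`.
    load≤b : ∀ {u} → u ∈ N → load u ≤ b
    load≤b {u} u∈ = ≤-trans (≤-reflexive (≡.sym (∑-filter x (inc u) Cs)))
      (s≤s⁻¹ (weigh (u ∷ []) (filter (λ C → inc u C Bool.≟ true) Cs)
                (λ { (here refl) → u∈ }) ([] ∷ [])
                (proj₁ ∘ ∈-filter⁻ _) (AllPairs.filter⁺ _ Cs!)
                (λ C∈ → u , here refl , proj₂ (∈-filter⁻ (λ C → inc u C Bool.≟ true) {xs = Cs} C∈) , λ { (here refl) _ → refl })))
  
    private
      -- A wasteful first cover, to be pruned: `suc (x C)` copies of one element incident with `C`,
      -- for each `C`.
      pool : ∀ Gs → (∀ {C} → C ∈ Gs → C ∈ Cs) →
             ∃ λ L → (∀ {u} → u ∈ L → u ∈ N) × Covers (suc ∘ x) Gs L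
      pool []       _  = [] , (λ ()) , []
      pool (C ∷ Gs) ⊆Cs = let L , L⊆ , cov = pool Gs (⊆Cs ∘ there)
                              u , u∈ , u∼C = hit (⊆Cs (here refl))
                              R = replicate (suc (x C)) u
        in R ++ L
         , (λ w∈ → [ (λ w∈R → subst (_∈ N) (≡.sym (∈-replicate⁻ (suc (x C)) w∈R)) u∈) , L⊆ ]′ (∈-++⁻ R w∈))
         , ≤-trans (≤-trans (≤-reflexive (≡.sym (count-replicate u∼C (suc (x C)))))
                            (m≤m+n _ (count C L)))
                   (≤-reflexive (≡.sym (∑-++ _ R L)))
           ∷ All.map (λ {D} ≤D → ≤-trans ≤D (≤-trans (m≤n+m _ (count D R)) (≤-reflexive (≡.sym (∑-++ _ R L))))) cov
        where
        ∈-replicate⁻ : ∀ n {u w : A} → w ∈ replicate n u → w ≡ u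
        ∈-replicate⁻ (suc n) (here refl) = refl
        ∈-replicate⁻ (suc n) (there w∈)  = ∈-replicate⁻ n w∈
        count-replicate : ∀ {u C} → inc u C ≡ true → ∀ n → count C (replicate n u) ≡ n
        count-replicate u∼C zero    = refl
        count-replicate u∼C (suc n) = cong₂ _+_ (cong ⟦_⟧ u∼C) (count-replicate u∼C n)

      initial : ∃ λ L → (∀ {u} → u ∈ L → u ∈ N) × Covers (suc ∘ x) Cs L
      initial = pool Cs (λ C∈ → C∈)

      pruned = prune (suc ∘ x) Cs (proj₁ initial) (proj₂ (proj₂ initial))

    zs : List A
    zs = proj₁ pruned

    zs⊆N : ∀ {u} → u ∈ zs → u ∈ N
    zs⊆N u∈ = proj₁ (proj₂ initial) (Sublist.lookup (proj₁ (proj₂ pruned)) u∈)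

    zs-covers : ∀ {C} → C ∈ Cs → suc (x C) ≤ count C zs
    zs-covers = All.lookup (proj₁ (proj₂ (proj₂ pruned)))

    zs-critical : ∀ {u} → u ∈ zs → Critical (suc ∘ x) Cs zs u
    zs-critical = proj₂ (proj₂ (proj₂ pruned))

    Tight : B → Set
    Tight C = count C zs ≤ suc (x C)

    -- A minimal cover of `zs` by tight edges. Minimality is kept as `own`: an element of degree at
    -- most 1 in `F` is private to its edge.
    record Family (F : List B) : Set where
      field
        F!     : Unique F
        F⊆Cs   : ∀ {C} → C ∈ F → C ∈ Cs
        tight  : ∀ {C} → C ∈ F → Tight C
        covers : ∀ {u} → u ∈ zs → 1 ≤ degree u F
        own    : ∀ {C} → C ∈ F → ∃ λ u → u ∈ zs × inc u C ≡ true × degree u F ≤ 1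

      Owner : A → B → Set
      Owner u C = u ∈ zs × inc u C ≡ true × (∀ {D} → D ∈ F → inc u D ≡ true → D ≡ C)

      owner : ∀ {C} → C ∈ F → ∃ λ u → Owner u C
      owner C∈ = let u , u∈ , u∼C , u≤1 = own C∈
                 in u , u∈ , u∼C , λ D∈ u∼D → degree≤1⇒≡ F u≤1 D∈ C∈ u∼D u∼C

      private
        -- An owner meets no other member of `F`, so choosing one per member yields distinct
        -- elements and hits each member once. `Q` lets further conditions be imposed on the choice,
        -- as in `swallows`.
        transversal′ : (Q : A → B → Set) → (∀ {u C} → Q u C → Owner u C) →
          ∀ F′ → (∀ {C} → C ∈ F′ → C ∈ F) → Unique F′ → (∀ {C} → C ∈ F′ → ∃ λ u → Q u C) →
          ∃ λ S → length S ≡ length F′ × Unique S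
                × (∀ {u} → u ∈ S → ∃ λ C → C ∈ F′ × Q u C)
                × (∀ {C} → C ∈ F′ → ∃ λ u → u ∈ S × Q u C × (∀ {w} → w ∈ S → inc w C ≡ true → w ≡ u))
        transversal′ Q Q⇒ []       ⊆F _ _ = [] , refl , [] , (λ ()) , (λ ())
        transversal′ Q Q⇒ (C ∷ F′) ⊆F (C∉ ∷ F′!) choose
          with transversal′ Q Q⇒ F′ (⊆F ∘ there) F′! (choose ∘ there) | choose (here refl)
        ... | S , |S| , S! , from , to | u , q =
            u ∷ S , cong suc |S|
          , All.tabulate (λ {w} w∈ u≡w → fresh w∈ (subst (λ t → inc t C ≡ true) u≡w (proj₁ (proj₂ (Q⇒ q))))) ∷ S!
          , (λ { (here refl) → C , here refl , q
               ; (there w∈)  → let D , D∈ , q′ = from w∈ in D , there D∈ , q′ })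
          , λ { (here refl) → u , here refl , q , λ { (here refl) _ → refl ; (there w∈) w∼C → ⊥-elim (fresh w∈ w∼C) }
              ; {D} (there D∈) → let w , w∈ , q′ , uniq = to D∈ in
                  w , there w∈ , q′ ,
                  λ { (here refl) u∼D → ⊥-elim (All.lookup C∉ D∈ (≡.sym (proj₂ (proj₂ (Q⇒ q)) (⊆F (there D∈)) u∼D)))
                    ; (there w′∈) → uniq w′∈ } }
          where
          fresh : ∀ {w} → w ∈ S → ¬ (inc w C ≡ true)
          fresh w∈ w∼C = let D , D∈ , q′ = from w∈
                         in All.lookup C∉ D∈ (proj₂ (proj₂ (Q⇒ q′)) (⊆F (here refl)) w∼C)

      transversal : (Q : A → B → Set) → (∀ {u C} → Q u C → Owner u C) → (∀ {C} → C ∈ F → ∃ λ u → Q u C) →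
          ∃ λ S → length S ≡ length F × Unique S
                × (∀ {u} → u ∈ S → ∃ λ C → C ∈ F × Q u C)
                × (∀ {C} → C ∈ F → ∃ λ u → u ∈ S × Q u C × (∀ {w} → w ∈ S → inc w C ≡ true → w ≡ u))
      transversal Q Q⇒ = transversal′ Q Q⇒ F (λ C∈ → C∈) F!

      -- A transversal of owners has as many elements as `F`, and `weigh` charges both, which turns
      -- `x` into `suc ∘ x`.
      demand≤ : ∑ (suc ∘ x) F ≤ suc b
      demand≤ = let S , |S| , S! , from , to = transversal Owner (λ o → o) owner in
        begin
          ∑ (suc ∘ x) F       ≡⟨ ∑-suc x F ⟩
          length F + ∑ x F    ≡⟨ cong (_+ ∑ x F) |S| ⟨
          length S + ∑ x F    ≤⟨ weigh S F (λ u∈ → zs⊆N (proj₁ (proj₂ (proj₂ (from u∈))))) S! F⊆Cs F!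
                                    (λ C∈ → let u , u∈ , (_ , u∼C , _) , uniq = to C∈ in u , u∈ , u∼C , uniq) ⟩
          suc b               ∎
        where open ≤-Reasoning

      ∑degree≤ : ∑ (λ u → degree u F) zs ≤ ∑ (suc ∘ x) F
      ∑degree≤ = ≤-trans (≤-reflexive (∑-swap (λ u C → ⟦ inc u C ⟧) zs F)) (∑-mono F tight)

      ones≤∑degree : length zs ≤ ∑ (λ u → degree u F) zs
      ones≤∑degree = ≤-trans (≤-reflexive (≡.sym (≡.trans (∑-const 1 zs) (*-identityʳ _)))) (∑-mono zs covers)

      -- Incidences between `zs` and `F` are counted in two ways: each element lies in some member,
      -- and a tight member `C` has at most `suc (x C)` of them.
      zs≤ : length zs ≤ suc b
      zs≤ = ≤-trans ones≤∑degree (≤-trans ∑degree≤ demand≤)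

    -- Pruning with the roles exchanged. For demand 1, criticality of an edge provides an element
    -- private to it, which is `own`.
    trim : ∀ F → Unique F → (∀ {C} → C ∈ F → C ∈ Cs) → (∀ {C} → C ∈ F → Tight C) →
           (∀ {u} → u ∈ zs → 1 ≤ degree u F) → ∃ λ F′ → F′ ⊑ F × Family F′
    trim F F! F⊆ tight covers =
      let F′ , F′⊑ , cov , crit = prune-family (λ _ → 1) zs F (All.tabulate covers)
      in F′ , F′⊑ , record
        { F! = Unique-⊑ F′⊑ F! ; F⊆Cs = F⊆ ∘ Sublist.lookup F′⊑ ; tight = tight ∘ Sublist.lookup F′⊑
        ; covers = All.lookup cov ; own = crit }

    family : ∃ Family
    family =
      let tight? = λ C → count C zs ≤? suc (x C)
          F , _ , fam = trim (filter tight? Cs) (AllPairs.filter⁺ tight? Cs!)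
            (proj₁ ∘ ∈-filter⁻ tight?) (λ C∈ → proj₂ (∈-filter⁻ tight? {xs = Cs} C∈))
            -- Criticality in `zs` puts a tight edge through each `u`, so the tight edges together
            -- cover `zs`.
            (λ u∈ → let C , C∈ , u∼C , t = zs-critical u∈ in degree⁺ (∈-filter⁺ tight? C∈ t) u∼C)
      in F , fam

    -- Twice the sum of the triangular numbers of the weights, so that no division by two occurs.
    squares : ℕ
    squares = ∑ (λ C → x C * suc (x C)) Cs

    squares≤covered : squares ≤ ∑ (λ C → x C * count C zs) Cs
    squares≤covered = ∑-mono Cs (λ {C} C∈ → *-monoʳ-≤ (x C) (zs-covers C∈))

    covered≡loads : ∑ (λ C → x C * count C zs) Cs ≡ ∑ load zs
    covered≡loads = ≡.trans
      (∑-cong Cs (λ {C} _ → ≡.sym (∑-*ˡ (x C) _ zs)))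
      (∑-swap (λ C u → x C * ⟦ inc u C ⟧) Cs zs)

    loads≤ : ∑ load zs ≤ length zs * b
    loads≤ = ≤-trans (∑-mono zs (load≤b ∘ zs⊆N)) (≤-reflexive (∑-const b zs))

    squares≤ : squares ≤ suc b * b
    squares≤ = ≤-trans squares≤covered (≤-trans (≤-reflexive covered≡loads)
                 (≤-trans loads≤ (*-monoˡ-≤ b (Family.zs≤ (proj₂ family)))))

    -- `extremal` reverses the estimate `squares≤`, so each inequality on the way is an equality.
    -- `b≥1` makes the factor `b` cancellable.
    module Extremal (_≟_ : DecidableEquality B) (b≥1 : 1 ≤ b) (extremal : suc b * b ≤ squares) where

      private instance
        b-nonZero : NonZero b
        b-nonZero = >-nonZero b≥1

      count≡ : ∀ {C} → C ∈ Cs → suc (x C) ≡ count C zs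
      count≡ {C} C∈ = *-cancelˡ-≡ _ _ (x C) ⦃ >-nonZero (x≥1 C∈) ⦄
        (∑-tight Cs (λ {C} C∈ → *-monoʳ-≤ (x C) (zs-covers C∈)) covered≤squares C∈)
        where
        covered≤squares : ∑ (λ C → x C * count C zs) Cs ≤ squares
        covered≤squares = ≤-trans (≤-reflexive covered≡loads)
          (≤-trans loads≤ (≤-trans (*-monoˡ-≤ b (Family.zs≤ (proj₂ family))) extremal))

      |zs|*b≤loads : suc b * b ≤ ∑ load zs
      |zs|*b≤loads = ≤-trans extremal (≤-trans squares≤covered (≤-reflexive covered≡loads))

      b<|zs| : suc b ≤ length zs
      b<|zs| = *-cancelʳ-≤ (suc b) (length zs) b (≤-trans |zs|*b≤loads loads≤)

      load≡b : ∀ {u} → u ∈ zs → load u ≡ b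
      load≡b = ∑-tight zs (load≤b ∘ zs⊆N)
        (≤-trans (≤-reflexive (∑-const b zs))
          (≤-trans (*-monoˡ-≤ b (Family.zs≤ (proj₂ family))) |zs|*b≤loads))

      module _ {F : List B} (fam : Family F) where
        open Family fam

        demand≡ : ∑ (suc ∘ x) F ≡ suc b
        demand≡ = ≤-antisym demand≤ (≤-trans b<|zs| (≤-trans ones≤∑degree ∑degree≤))

        degree≡1 : ∀ {u} → u ∈ zs → 1 ≡ degree u F
        degree≡1 = ∑-tight zs covers
          (≤-trans ∑degree≤ (≤-trans demand≤ (≤-trans b<|zs|
            (≤-reflexive (≡.sym (≡.trans (∑-const 1 zs) (*-identityʳ _)))))))

        -- By `degree≡1` the members of `F` partition `zs`, so an incident element is automatically
        -- an owner.
        ownership : ∀ {u C} → u ∈ zs → C ∈ F → inc u C ≡ true → Owner u C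
        ownership u∈ C∈ u∼C = u∈ , u∼C , λ D∈ u∼D →
          degree≤1⇒≡ F (≤-reflexive (≡.sym (degree≡1 u∈))) D∈ C∈ u∼D u∼C

        -- With `C` alone at `u`, the load `b` of `u` would be at most `x C`; but
        -- `suc (x C) + suc (x D)` is at most `suc b`.
        second-edge : ∀ {C D u} → C ∈ F → D ∈ F → C ≢ D → Owner u C →
                      ∃ λ E → E ∈ Cs × inc u E ≡ true × E ≢ C
        second-edge {C} {D} {u} C∈ D∈ C≢D (u∈ , u∼C , _)
          with any? (λ E → (inc u E Bool.≟ true) ×-dec ¬? (E ≟ C)) Cs
        ... | yes found = let E , E∈ , u∼E , E≢C = find found in E , E∈ , u∼E , E≢C
        ... | no none = ⊥-elim (<⇒≱ xC<b b≤xC)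
          where
          only : ∀ {E} → E ∈ Cs → x E * ⟦ inc u E ⟧ ≡ 0 ⊎ E ≡ C
          only {E} E∈ with inc u E in u∼E | E ≟ C
          ... | _     | yes E≡C = inj₂ E≡C
          ... | false | no _    = inj₁ (*-zeroʳ (x E))
          ... | true  | no E≢C  = ⊥-elim (none (lose E∈ (u∼E , E≢C)))
          b≤xC : b ≤ x C
          b≤xC = begin
            b                   ≡⟨ load≡b u∈ ⟨
            load u              ≤⟨ ∑-single _ Cs! only ⟩
            x C * ⟦ inc u C ⟧   ≡⟨ cong (λ t → x C * ⟦ t ⟧) u∼C ⟩
            x C * 1             ≡⟨ *-identityʳ (x C) ⟩
            x C                 ∎
            where open ≤-Reasoning
          xC<b : x C < b
          xC<b = s≤s⁻¹ (begin-strict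
            suc (x C)                <⟨ m<m+n (suc (x C)) (s≤s z≤n) ⟩
            suc (x C) + suc (x D)    ≤⟨ ∑-pair (suc ∘ x) C∈ D∈ C≢D ⟩
            ∑ (suc ∘ x) F            ≤⟨ demand≤ ⟩
            suc b                    ∎)
            where open ≤-Reasoning

        private
          _⊆?_ : ∀ D E → Dec (All (λ w → inc w D ≡ true → inc w E ≡ true) zs)
          D ⊆? E = all? (λ w → (inc w D Bool.≟ true) →-dec (inc w E Bool.≟ true)) zs

        -- Otherwise some transversal of F avoids E except at u, and E could be added to the weighed edges.
        swallows : ∀ {C u E} → C ∈ F → Owner u C → E ∈ Cs → inc u E ≡ true → E ≢ C →
                   ∃ λ D → D ∈ F × D ≢ C × All (λ w → inc w D ≡ true → inc w E ≡ true) zs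
        swallows {C} {u} {E} C∈ owner-u E∈ u∼E E≢C
          with any? (λ D → ¬? (D ≟ C) ×-dec (D ⊆? E)) F
        ... | yes found = let D , D∈ , D≢C , D⊆E = find found in D , D∈ , D≢C , D⊆E
        ... | no none = ⊥-elim (<⇒≱ overweight
                (weigh S (E ∷ F) (λ w∈ → zs⊆N (proj₁ (proj₁ (proj₂ (proj₂ (from w∈)))))) S!
                  (λ { (here refl) → E∈ ; (there D∈) → F⊆Cs D∈ })
                  (All.tabulate (λ D∈ E≡D → E∉F (subst (_∈ F) (≡.sym E≡D) D∈)) ∷ F!)
                  (λ { (here refl) → u , u∈S , u∼E , λ w∈ w∼E → proj₁ (proj₂ (proj₂ (proj₂ (from w∈)))) w∼E
                     ; (there D∈) → let w , w∈ , ((_ , w∼D , _) , _) , uniq = to D∈ in w , w∈ , w∼D , uniq })))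
          where
          Q : A → B → Set
          -- The second clause keeps everything except `u` away from `E`; the third forces `u` to be
          -- the element chosen at `C`, so that `E` is hit.
          Q w D = Owner w D × (inc w E ≡ true → w ≡ u) × (D ≡ C → w ≡ u)

          choose : ∀ {D} → D ∈ F → ∃ λ w → Q w D
          choose {D} D∈ with D ≟ C
          ... | yes refl = u , owner-u , (λ _ → refl) , (λ _ → refl)
          ... | no D≢C =
            let w , w∈ , ¬sub = find (¬All⇒Any¬ (λ w → (inc w D Bool.≟ true) →-dec (inc w E Bool.≟ true)) zs
                                        (λ D⊆E → none (lose D∈ (D≢C , D⊆E))))
                w∼D = decidable-stable (inc w D Bool.≟ true) (λ w≁D → ¬sub (⊥-elim ∘ w≁D))
            in w , ownership w∈ D∈ w∼D , (λ w∼E → ⊥-elim (¬sub (λ _ → w∼E))) , (λ D≡C → ⊥-elim (D≢C D≡C))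

          chosen = transversal Q proj₁ choose
          S = proj₁ chosen
          |S| = proj₁ (proj₂ chosen)
          S! = proj₁ (proj₂ (proj₂ chosen))
          from = proj₁ (proj₂ (proj₂ (proj₂ chosen)))
          to = proj₂ (proj₂ (proj₂ (proj₂ chosen)))

          u∈S : u ∈ S
          u∈S = let w , w∈ , (_ , _ , w≡u) , _ = to C∈ in subst (_∈ S) (w≡u refl) w∈

          E∉F : ¬ (E ∈ F)
          E∉F E∈F = E≢C (proj₂ (proj₂ owner-u) E∈F u∼E)

          -- `F` with its transversal already exhausts `suc b`, and `E` adds at least 1.
          overweight : suc b < length S + ∑ x (E ∷ F)
          overweight = begin-strict
            suc b                       ≡⟨ demand≡ ⟨
            ∑ (suc ∘ x) F               ≡⟨ ∑-suc x F ⟩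
            length F + ∑ x F            ≡⟨ cong (_+ ∑ x F) |S| ⟨
            length S + ∑ x F            <⟨ +-monoʳ-< (length S) (m<n+m (∑ x F) (x≥1 E∈)) ⟩
            length S + ∑ x (E ∷ F)      ∎
            where open ≤-Reasoning

        -- The edge `E` contains the trace on `zs` of some `D₁`, hence meets the owner of `D₁`, and
        -- so contains the trace of a second member `D₂`, possibly `C`. Replacing all such members
        -- by `E` loses at least two and gains one.
        smaller : ∀ {C D} → C ∈ F → D ∈ F → C ≢ D → ∃ λ F′ → Family F′ × length F′ < length F
        smaller {C} {D} C∈ D∈ C≢D =
          let u  , owner-u = owner C∈
              E  , E∈ , u∼E , E≢C = second-edge C∈ D∈ C≢D owner-u
              D₁ , D₁∈ , D₁≢C , D₁⊆E = swallows C∈ owner-u E∈ u∼E E≢C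
              w  , owner-w = owner D₁∈
              E≢D₁ = λ E≡D₁ → D₁≢C (proj₂ (proj₂ owner-u) D₁∈ (subst (λ t → inc u t ≡ true) E≡D₁ u∼E))
              D₂ , D₂∈ , D₂≢D₁ , D₂⊆E = swallows D₁∈ owner-w E∈ (All.lookup D₁⊆E (proj₁ owner-w) (proj₁ (proj₂ owner-w))) E≢D₁
              E⊉? = λ G → ¬? (G ⊆? E)
              E∉F = λ E∈F → E≢C (proj₂ (proj₂ owner-u) E∈F u∼E)
              F′ , F′⊑ , fam′ = trim (E ∷ filter E⊉? F)
                (All.tabulate (λ G∈ E≡G → E∉F (subst (_∈ F) (≡.sym E≡G) (proj₁ (∈-filter⁻ E⊉? G∈)))) ∷ AllPairs.filter⁺ E⊉? F!)
                (λ { (here refl) → E∈ ; (there G∈) → F⊆Cs (proj₁ (∈-filter⁻ E⊉? G∈)) })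
                -- In the extremal case every edge is tight, so `E` may join the family.
                (λ { (here refl) → ≤-reflexive (≡.sym (count≡ E∈)) ; (there G∈) → tight (proj₁ (∈-filter⁻ E⊉? G∈)) })
                (λ {t} t∈ → let G , G∈ , t∼G = degree⁻ F (covers t∈) in
                   case G ⊆? E of λ
                     { (yes G⊆E) → degree⁺ {xs = E ∷ filter E⊉? F} (here refl) (All.lookup G⊆E t∈ t∼G)
                     ; (no G⊈E)  → degree⁺ {xs = E ∷ filter E⊉? F} (there (∈-filter⁺ E⊉? G∈ G⊈E)) t∼G })
          in F′ , fam′ , ≤-trans (s≤s (HeteroSublist.length-mono-≤ F′⊑))
                           (filter-drops-two E⊉? D₁∈ D₂∈ (D₂≢D₁ ∘ ≡.sym) (λ ¬⊆ → ¬⊆ D₁⊆E) (λ ¬⊆ → ¬⊆ D₂⊆E))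

      -- Exchange until one member is left: it carries all of `demand≡` and meets every element of
      -- `zs`. The empty family is excluded because its demand is 0.
      spanning : ∀ fuel {F} → Family F → length F ≤ fuel →
                 ∃ λ C → C ∈ Cs × x C ≡ b × (∀ {u} → u ∈ zs → inc u C ≡ true)
      spanning fuel {[]} fam _ = case demand≡ fam of λ ()
      spanning fuel {C ∷ []} fam _ =
          C , Family.F⊆Cs fam (here refl)
        , suc-injective (≡.trans (≡.sym (+-identityʳ _)) (demand≡ fam))
        , λ u∈ → case degree⁻ (C ∷ []) (Family.covers fam u∈) of λ { (_ , here refl , u∼C) → u∼C }
      spanning (suc fuel) {C ∷ D ∷ F} fam |F|≤ with Family.F! fam
      ... | (C≢D ∷ _) ∷ _ =
        let F′ , fam′ , F′< = smaller fam (here refl) (there (here refl)) C≢D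
        in spanning fuel fam′ (s≤s⁻¹ (≤-trans F′< |F|≤))

      -- The spanning edge alone gives each element of `zs` its full load `b`. Any other edge would
      -- meet some element of `zs` and push its load above `b`.
      single-edge : ∃ λ C → Cs ≡ C ∷ [] × x C ≡ b
      single-edge =
        let C , C∈ , xC≡b , spans = spanning _ (proj₂ family) ≤-refl
        in C , Unique-const⇒singleton Cs! C∈ (λ {E} E∈ →
             let u , u∈ , u∼E = count⁻ zs (≤-trans (s≤s z≤n) (zs-covers E∈))
             in decidable-stable (E ≟ C) λ E≢C → <⇒≱ (x≥1 E∈)
                  (+-cancelˡ-≤ b _ _ (begin
                     b + x E                                  ≡⟨ cong₂ _+_ (≡.trans (≡.sym xC≡b) (incident (spans u∈))) (incident u∼E) ⟩
                     x C * ⟦ inc u C ⟧ + x E * ⟦ inc u E ⟧    ≤⟨ ∑-pair _ C∈ E∈ (E≢C ∘ ≡.sym) ⟩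
                     load u                                   ≡⟨ load≡b u∈ ⟩
                     b                                        ≡⟨ +-identityʳ b ⟨
                     b + 0                                    ∎)))
           , xC≡b
        where
        open ≤-Reasoning
        incident : ∀ {u C} → inc u C ≡ true → x C ≡ x C * ⟦ inc u C ⟧
        incident {u} {C} u∼C rewrite u∼C = ≡.sym (*-identityʳ (x C))

-- Triangular numbers

tri : ℕ → ℕ
tri zero    = 0
tri (suc b) = suc b + tri b

tri-double : ∀ b → tri b + tri b ≡ b * suc b
tri-double zero    = refl
tri-double (suc b) = begin
  suc b + tri b + (suc b + tri b)     ≡⟨ solve 2 (λ s t → s :+ t :+ (s :+ t) := s :+ s :+ (t :+ t)) refl (suc b) (tri b) ⟩
  suc b + suc b + (tri b + tri b)     ≡⟨ cong (suc b + suc b +_) (tri-double b) ⟩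
  suc b + suc b + b * suc b           ≡⟨ solve 1 (λ b → (con 1 :+ b) :+ (con 1 :+ b) :+ b :* (con 1 :+ b) := (con 1 :+ b) :* (con 2 :+ b)) refl b ⟩
  suc b * suc (suc b)                 ∎
  where
  open ≡-Reasoning
  open +-*-Solver

tri-mono : ∀ {s r} → s ≤ r → tri s ≤ tri r
tri-mono z≤n       = z≤n
tri-mono (s≤s s≤r) = +-mono-≤ (s≤s s≤r) (tri-mono s≤r)

triRoot : ∀ m → ∃ λ r → m ≤ tri r × (∀ {s} → s < r → tri s < m)
triRoot zero = 0 , z≤n , λ ()
triRoot (suc m) with triRoot m
... | r , m≤ , least with suc m ≤? tri r
...   | yes m< = r , m< , λ s<r → m≤n⇒m≤1+n (least s<r)
...   | no  m≮ = suc r , s≤s (m≤n⇒m≤o+n r m≤) , λ s<1+r → s≤s (≤-trans (tri-mono (s≤s⁻¹ s<1+r)) (s≤s⁻¹ (≰⇒> m≮)))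

abstract
  -- The weight x of a component in the overview. `root-upper` turns weights into vertex counts;
  -- `root-least` forces a large tree in `tree`.
  root : List A → ℕ
  root C = proj₁ (triRoot (length C))

  root-upper : ∀ (C : List A) → length C ≤ tri (root C)
  root-upper C = proj₁ (proj₂ (triRoot (length C)))

  root-least : ∀ (C : List A) {s} → s < root C → tri s < length C
  root-least C = proj₂ (proj₂ (triRoot (length C)))

root≥1 : ∀ {C : List A} {x} → x ∈ C → 1 ≤ root C
root≥1 {C = C} x∈ with root C | root-upper C
... | zero  | |C|≤0 = ≤-trans (∈-length x∈) |C|≤0
... | suc _ | _     = s≤s z≤n

-- Induced trees and components

module Trees {n} (G : Graph n) (triangle-free : TriangleFree G) where

  V : Set
  V = Fin n

  infix 4 _~_ _~?_
  _~_ : V → V → Set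
  x ~ y = Edge G x y

  _~?_ : ∀ x y → Dec (x ~ y)
  x ~? y = adj G x y Bool.≟ true

  ~-sym : ∀ {x y} → x ~ y → y ~ x
  ~-sym {x} {y} x~y = ≡.trans (Graph.sym G y x) x~y

  ~⇒≢ : ∀ {x y} → x ~ y → x ≢ y
  ~⇒≢ {x} x~x refl = case ≡.trans (≡.sym x~x) (irrefl G x) of λ ()

  no-triangle : ∀ {x y z} → x ~ y → x ~ z → ¬ y ~ z
  no-triangle x~y x~z y~z = triangle-free (_ , _ , _ , x~y , y~z , x~z)

  -- The newest vertex comes first; each vertex has exactly one neighbour among the older ones and B.
  data Grow (B : List V) : List V → Set where
    []     : Grow B []
    attach : ∀ {x p l} → Grow B l → x ∉ l ++ B → p ∈ l ++ B → x ~ p →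
             (∀ {q} → q ∈ l ++ B → x ~ q → q ≡ p) → Grow B (x ∷ l)

  Grow-++ : ∀ {B T l} → Grow (T ++ B) l → Grow B T → Grow B (l ++ T)
  Grow-++ [] t = t
  Grow-++ {B} {T} (attach {x} {p} {l} g x∉ p∈ x~p only) t =
    attach (Grow-++ g t) (subst (x ∉_) assoc x∉) (subst (p ∈_) assoc p∈) x~p
           (λ {q} q∈ → only (subst (q ∈_) (≡.sym assoc) q∈))
    where assoc = ≡.sym (++-assoc l T B)

  -- Passing from the base `u` to the larger base `T` creates no further older neighbour, since
  -- vertices of `D` see nothing of `T` but `u`.
  Grow-lift : ∀ {u T D l} → Grow (u ∷ []) l → (∀ {x} → x ∈ l → x ∈ D) → u ∈ T →
              (∀ {x} → x ∈ D → x ∉ T) → (∀ {x q} → x ∈ D → q ∈ T → x ~ q → q ≡ u) → Grow T l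
  Grow-lift [] _ _ _ _ = []
  Grow-lift {u} {T} (attach {x} {p} {l} g x∉ p∈ x~p only) l⊆D u∈T D∩T attached =
    attach (Grow-lift g (l⊆D ∘ there) u∈T D∩T attached)
           (λ x∈ → [ x∉ ∘ ∈-++⁺ˡ , D∩T (l⊆D (here refl)) ]′ (∈-++⁻ l x∈))
           ([ ∈-++⁺ˡ , (λ { (here refl) → ∈-++⁺ʳ l u∈T }) ]′ (∈-++⁻ l p∈))
           x~p
           (λ q∈ x~q → [ (λ q∈l → only (∈-++⁺ˡ q∈l) x~q)
                       , (λ q∈T → case attached (l⊆D (here refl)) q∈T x~q of
                                    λ { refl → only (∈-++⁺ʳ l (here refl)) x~q }) ]′ (∈-++⁻ l q∈))

  -- Leaves with the common neighbour `p` are pairwise non-adjacent by triangle-freeness.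
  Grow-leaves : ∀ {B S p} → Unique S → p ∈ B → (∀ {x} → x ∈ S → x ~ p) → (∀ {x} → x ∈ S → x ∉ B) →
                (∀ {x q} → x ∈ S → q ∈ B → x ~ q → q ≡ p) → Grow B S
  Grow-leaves [] _ _ _ _ = []
  Grow-leaves {S = x ∷ S} (x∉S ∷ S!) p∈ S~p S∩B only =
    attach (Grow-leaves S! p∈ (S~p ∘ there) (S∩B ∘ there) (only ∘ there))
           (λ x∈ → [ (λ x∈S → All.lookup x∉S x∈S refl) , S∩B (here refl) ]′ (∈-++⁻ S x∈))
           (∈-++⁺ʳ S p∈) (S~p (here refl))
           (λ q∈ x~q → [ (λ q∈S → ⊥-elim (no-triangle (~-sym (S~p (here refl))) (~-sym (S~p (there q∈S))) x~q))
                       , (λ q∈B → only (here refl) q∈B x~q) ]′ (∈-++⁻ S q∈))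

  Grow-star : ∀ {v S} → Unique S → (∀ {x} → x ∈ S → v ~ x) → Grow (v ∷ []) S
  Grow-star S! v~S = Grow-leaves S! (here refl) (~-sym ∘ v~S)
    (λ { x∈ (here refl) → ~⇒≢ (v~S x∈) refl }) (λ { _ (here refl) _ → refl })

  -- Connectedness via two-colourings, which avoids handling paths inside sublists.
  Conn : List V → Set
  Conn L = ∀ (χ : V → Bool) → (∀ {x y} → x ∈ L → y ∈ L → x ~ y → χ x ≡ χ y) →
           ∀ {x y} → x ∈ L → y ∈ L → χ x ≡ χ y

  Sep : List V → List V → Set
  Sep C D = ∀ {x y} → x ∈ C → y ∈ D → x ≢ y × ¬ x ~ y

  Sep-sym : ∀ {C D} → Sep C D → Sep D C
  Sep-sym s y∈ x∈ = let x≢y , x≁y = s x∈ y∈ in x≢y ∘ ≡.sym , x≁y ∘ ~-sym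

  Touches : V → List V → Set
  Touches u C = Any (u ~_) C

  touches? : ∀ u C → Dec (Touches u C)
  touches? u = any? (u ~?_)

  record Components (H : List V) (Cs : List (List V)) : Set where
    field
      perm      : concat Cs ↭ H
      separated : AllPairs Sep Cs
      connected : All Conn Cs
      inhabited : All (λ C → ∃ λ x → x ∈ C) Cs

    distinct : Unique Cs
    distinct = go separated inhabited
      where
      go : ∀ {Cs} → AllPairs Sep Cs → All (λ C → ∃ λ x → x ∈ C) Cs → Unique Cs
      go []       []               = []
      go (s ∷ ss) ((x , x∈) ∷ inh) =
        All.map (λ { sep refl → proj₁ (sep x∈ x∈) refl }) s ∷ go ss inh

    apart : ∀ {C D} → C ∈ Cs → D ∈ Cs → C ≢ D → Sep C D
    apart C∈ D∈ C≢D with ∈-AllPairs₂ separated C∈ D∈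
    ... | inj₁ C≡D        = ⊥-elim (C≢D C≡D)
    ... | inj₂ (inj₁ C|D) = C|D
    ... | inj₂ (inj₂ D|C) = Sep-sym D|C

    ⊆H : ∀ {C x} → C ∈ Cs → x ∈ C → x ∈ H
    ⊆H C∈ x∈ = ∈-resp-↭ perm (∈-concat⁺′ x∈ C∈)

    component : ∀ {x} → x ∈ H → ∃ λ C → x ∈ C × C ∈ Cs
    component x∈ = ∈-concat⁻′ Cs (∈-resp-↭ (↭-sym perm) x∈)

  -- Vertices are inserted one at a time; the new `w` fuses the components it touches into one and
  -- leaves the others alone.
  components : ∀ H → Unique H → ∃ (Components H)
  components [] _ = [] , record { perm = refl ; separated = [] ; connected = [] ; inhabited = [] }
  components (w ∷ H) (w∉H ∷ H!) with components H H!
  ... | Cs , comps = (w ∷ concat near) ∷ far , record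
      { perm = prep w (↭-trans (↭-reflexive (concat-++ near far))
                 (↭-trans (concat-↭ (↭-sym (filter-↭-partition (touches? w) Cs))) perm))
      ; separated = All.tabulate near|far ∷ AllPairs.filter⁺ (∁? (touches? w)) separated
      ; connected = merged ∷ All.tabulate (λ C∈ → All.lookup connected (proj₁ (∈-far C∈)))
      ; inhabited = (w , here refl) ∷ All.tabulate (λ C∈ → All.lookup inhabited (proj₁ (∈-far C∈)))
      }
    where
    open Components comps
    near = filter (touches? w) Cs
    far  = filter (∁? (touches? w)) Cs

    ∈-near : ∀ {C} → C ∈ near → C ∈ Cs × Touches w C
    ∈-near = ∈-filter⁻ (touches? w)

    ∈-far : ∀ {C} → C ∈ far → C ∈ Cs × ¬ Touches w C
    ∈-far = ∈-filter⁻ (∁? (touches? w))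

    near|far : ∀ {D} → D ∈ far → Sep (w ∷ concat near) D
    near|far D∈ (here refl) y∈ =
      All.lookup w∉H (⊆H (proj₁ (∈-far D∈)) y∈) , λ w~y → proj₂ (∈-far D∈) (lose y∈ w~y)
    near|far D∈ (there x∈) y∈ = let C , x∈C , C∈ = ∈-concat⁻′ near x∈ in
      apart (proj₁ (∈-near C∈)) (proj₁ (∈-far D∈))
            (λ { refl → proj₂ (∈-far D∈) (proj₂ (∈-near C∈)) }) x∈C y∈

    merged : Conn (w ∷ concat near)
    merged χ mono x∈ y∈ = ≡.trans (χ≡w x∈) (≡.sym (χ≡w y∈))
      where
      χ≡w : ∀ {x} → x ∈ w ∷ concat near → χ x ≡ χ w
      χ≡w (here refl) = refl
      χ≡w (there x∈) =
        let C , x∈C , C∈ = ∈-concat⁻′ near x∈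
            z , z∈C , w~z = find (proj₂ (∈-near C∈))
            lift = λ {t} (t∈ : t ∈ C) → there {x = w} (∈-concat⁺′ t∈ C∈)
        in ≡.trans (All.lookup connected (proj₁ (∈-near C∈)) χ (λ s∈ t∈ → mono (lift s∈) (lift t∈)) x∈C z∈C)
                   (≡.sym (mono (here refl) (lift z∈C) w~z))

-- Induction on the number of vertices

module Rooted {n} (G : Graph n) (triangle-free : TriangleFree G) where
  open Trees G triangle-free public

  -- The recursive shape of `GkV (suc a)` on `v ∷ R`: removing `v` and shrinking the first layer `N`
  -- to a representative `u` leaves the same shape with parameter one smaller. By the last argument,
  -- deeper vertices do not distinguish `u` from the rest of `N`.
  data Layered : ℕ → V → List V → Set where
    single : ∀ {v} → Layered 0 v []
    layer  : ∀ {b v u R} N R′ → R ↭ N ++ R′ → length N ≡ suc b →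
             (∀ {x} → x ∈ N → v ~ x) → (∀ {x} → x ∈ R′ → ¬ v ~ x) →
             u ∈ N → Layered b u R′ → (∀ {x w} → x ∈ N → w ∈ R′ → adj G x w ≡ adj G u w) →
             Layered (suc b) v R

  firstLayer : ∀ {a v R} → Unique R → Layered a v R →
               ∃ λ N → Unique N × length N ≡ a × (∀ {x} → x ∈ N → x ∈ R) × (∀ {x} → x ∈ N → v ~ x)
  firstLayer _ single = [] , [] , refl , (λ ()) , (λ ())
  firstLayer R! (layer N R′ R↭ |N| v~N _ _ _ _) =
    N , Unique-++⁻ˡ N (Unique-resp-↭ R↭ R!) , |N| , ∈-resp-↭ (↭-sym R↭) ∘ ∈-++⁺ˡ , v~N

  Bounded : V → List V → ℕ → Set
  Bounded v R a = ∀ {l} → Grow (v ∷ []) l → (∀ {x} → x ∈ l → x ∈ R) → length l ≤ a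

  -- `a` and `v` are quantified inside because the recursion passes to a component, with a neighbour
  -- of `v` as root and a parameter of its own.
  Claim : ℕ → Set
  Claim fuel = ∀ a v R → length R ≤ fuel → Unique (v ∷ R) → Conn (v ∷ R) → Bounded v R a →
               length R ≤ tri a × (length R ≡ tri a → Layered a v R)

  module Step {fuel} (IH : Claim fuel) {v R} (|R|≤ : length R ≤ suc fuel) (vR! : Unique (v ∷ R))
              (conn : Conn (v ∷ R)) {Cs} (comps : Components (filter (∁? (v ~?_)) R) Cs) where

    open DecMembership (_≟_ {n}) using (_∈?_)
    open Components comps

    N H : List V
    N = filter (v ~?_) R
    H = filter (∁? (v ~?_)) R

    v∉R : v ∉ R
    v∉R v∈ = case vR! of λ { (v∉ ∷ _) → All.lookup v∉ v∈ refl }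

    R! : Unique R
    R! = case vR! of λ { (_ ∷ R!) → R! }

    N! : Unique N
    N! = AllPairs.filter⁺ (v ~?_) R!

    ∈N⇒ : ∀ {x} → x ∈ N → x ∈ R × v ~ x
    ∈N⇒ = ∈-filter⁻ (v ~?_)

    ∈H⇒ : ∀ {x} → x ∈ H → x ∈ R × ¬ v ~ x
    ∈H⇒ = ∈-filter⁻ (∁? (v ~?_))

    R↭ : R ↭ N ++ concat Cs
    R↭ = ↭-trans (filter-↭-partition (v ~?_) R) (++⁺ˡ N (↭-sym perm))

    |R|≡ : length R ≡ length N + ∑ length Cs
    |R|≡ = ≡.trans (↭-length R↭) (≡.trans (length-++ N) (cong (length N +_) (length-concat Cs)))

    ∈C⇒∈R : ∀ {C x} → C ∈ Cs → x ∈ C → x ∈ R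
    ∈C⇒∈R C∈ x∈ = proj₁ (∈H⇒ (⊆H C∈ x∈))

    ∈C⇒≁v : ∀ {C x} → C ∈ Cs → x ∈ C → ¬ v ~ x
    ∈C⇒≁v C∈ x∈ = proj₂ (∈H⇒ (⊆H C∈ x∈))

    ∈C⇒∉N : ∀ {C x} → C ∈ Cs → x ∈ C → x ∉ N
    ∈C⇒∉N C∈ x∈C x∈N = ∈C⇒≁v C∈ x∈C (proj₂ (∈N⇒ x∈N))

    -- Without such a `u`, membership in `C` would be constant along all edges of `v ∷ R`, hence
    -- constant there by `Conn`; but `C` is inhabited and misses `v`.
    attached : ∀ {C} → C ∈ Cs → ∃ λ u → u ∈ N × Touches u C
    attached {C} C∈ with any? (λ u → touches? u C) N
    ... | yes found = find found
    ... | no none = let y , y∈ = All.lookup inhabited C∈ in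
        case ≡.trans (≡.sym (dec-false (v ∈? C) (v∉R ∘ ∈C⇒∈R C∈)))
               (≡.trans (conn (λ x → does (x ∈? C)) (λ {x} {y} x∈ y∈ x~y →
                           does-⇔ (mk⇔ (closed y∈ x~y) (closed x∈ (~-sym x~y))) (x ∈? C) (y ∈? C))
                          (here refl) (there (∈C⇒∈R C∈ y∈)))
                 (dec-true (y ∈? C) y∈)) of λ ()
        where
        closed : ∀ {x y} → y ∈ v ∷ R → x ~ y → x ∈ C → y ∈ C
        closed (here refl) x~v x∈ = ⊥-elim (∈C⇒≁v C∈ x∈ (~-sym x~v))
        closed {x} {y} (there y∈R) x~y x∈ with v ~? y
        ... | yes v~y = ⊥-elim (none (lose (∈-filter⁺ (v ~?_) y∈R v~y) (lose x∈ (~-sym x~y))))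
        ... | no v≁y  =
          let D , y∈D , D∈ = component (∈-filter⁺ (∁? (v ~?_)) y∈R v≁y)
          in case ≡-dec _≟_ C D of λ
               { (yes refl) → y∈D
               ; (no C≢D)   → ⊥-elim (proj₂ (apart C∈ D∈ C≢D x∈ y∈D) x~y) }

    -- At least one vertex of `R`, a neighbour of `v`, lies outside `C`; this makes the recursion
    -- decrease.
    |C|≤fuel : ∀ {C} → C ∈ Cs → length C ≤ fuel
    |C|≤fuel C∈ = let u , u∈ , _ = attached C∈ in
      s≤s⁻¹ (≤-trans (+-mono-≤ (∈-length u∈) (∑-member length C∈))
                     (≤-trans (≤-reflexive (≡.sym |R|≡)) |R|≤))

    rooted-unique : ∀ {C u} → C ∈ Cs → u ∈ N → Unique (u ∷ C)
    rooted-unique C∈ u∈ =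
        All.tabulate (λ x∈C u≡x → ∈C⇒∉N C∈ x∈C (subst (_∈ N) u≡x u∈))
      ∷ Unique-⊑ (∈⇒⊑-concat C∈) (Unique-++⁻ʳ N (Unique-resp-↭ R↭ R!))

    rooted-conn : ∀ {C u} → C ∈ Cs → Touches u C → Conn (u ∷ C)
    rooted-conn {C} {u} C∈ u~C χ mono x∈ y∈ = ≡.trans (χ≡u x∈) (≡.sym (χ≡u y∈))
      where
      χ≡u : ∀ {x} → x ∈ u ∷ C → χ x ≡ χ u
      χ≡u (here refl) = refl
      χ≡u (there x∈) = let z , z∈ , u~z = find u~C in
        ≡.trans (All.lookup connected C∈ χ (λ s∈ t∈ → mono (there s∈) (there t∈)) x∈ z∈)
                (≡.sym (mono (here refl) (there z∈) u~z))

    -- Let `root C` be `suc s`. If all trees had at most `s` vertices besides `u`, the induction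
    -- hypothesis would bound `C` by `tri s`, against leastness. The double negation is harmless, as
    -- the final goal `weigh` is decidable.
    tree : ∀ {C u} → C ∈ Cs → u ∈ N → Touches u C →
           ¬ ¬ (∃ λ l → Grow (u ∷ []) l × (∀ {x} → x ∈ l → x ∈ C) × root C ≤ length l)
    tree {C} {u} C∈ u∈ u~C none with root C | root-least C | root≥1 {C = C} (proj₂ (All.lookup inhabited C∈))
    ... | suc s | least | _ = <⇒≱ (least ≤-refl)
      (proj₁ (IH s u C (|C|≤fuel C∈) (rooted-unique C∈ u∈) (rooted-conn C∈ u~C)
        (λ {l} g l⊆ → ≮⇒≥ (λ s<|l| → none (l , g , l⊆ , s<|l|)))))

    inc : V → List V → Bool
    inc u C = does (touches? u C)

    inc⇒ : ∀ {u C} → inc u C ≡ true → Touches u C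
    inc⇒ {u} {C} i with touches? u C
    ... | yes t = t

    inc⇐ : ∀ {u C} → Touches u C → inc u C ≡ true
    inc⇐ {u} {C} = dec-true (touches? u C)

    root-positive : ∀ {C} → C ∈ Cs → 1 ≤ root C
    root-positive C∈ = root≥1 (proj₂ (All.lookup inhabited C∈))

    hit : ∀ {C} → C ∈ Cs → ∃ λ u → u ∈ N × inc u C ≡ true
    hit C∈ = let u , u∈ , u~C = attached C∈ in u , u∈ , inc⇐ u~C

    open Hypergraph inc N Cs root

    module _ {a} (bounded : Bounded v R a) where

      |N|≤ : length N ≤ a
      |N|≤ = bounded (Grow-star N! (proj₂ ∘ ∈N⇒)) (proj₁ ∘ ∈N⇒)

      -- The trees do not interfere: distinct components are non-adjacent, `v` sees none of them,
      -- and each sees only one element of `S`.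
      forest : ∀ {S} → (∀ {u} → u ∈ S → u ∈ N) →
               ∀ Gs → (∀ {C} → C ∈ Gs → C ∈ Cs) → Unique Gs → (∀ {C} → C ∈ Gs → HitOnce S C) →
               ¬ ¬ (∃ λ l → Grow (S ++ v ∷ []) l × (∀ {x} → x ∈ l → x ∈ concat Gs) × ∑ root Gs ≤ length l)
      forest S⊆ [] _ _ _ none = none ([] , [] , (λ ()) , z≤n)
      forest {S} S⊆ (C ∷ Gs) ⊆Cs (C∉ ∷ Gs!) once none =
        forest S⊆ Gs (⊆Cs ∘ there) Gs! (once ∘ there) λ (l , g , l⊆ , ∑≤) →
        let C∈ = ⊆Cs (here refl)
            u , u∈ , u∼C , only = once (here refl)
            away : ∀ {x q} → x ∈ C → q ∈ l → x ≢ q × ¬ x ~ q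
            away = λ x∈ q∈ → let D , q∈D , D∈ = ∈-concat⁻′ Gs (l⊆ q∈)
                             in apart C∈ (⊆Cs (there D∈)) (All.lookup C∉ D∈) x∈ q∈D
        in tree C∈ (S⊆ u∈) (inc⇒ u∼C) λ (l′ , g′ , l′⊆ , |l′|≥) → none
          ( l′ ++ l
          , Grow-++ (Grow-lift g′ l′⊆ (∈-++⁺ʳ l (∈-++⁺ˡ u∈))
              (λ x∈C x∈ → [ (λ x∈l → proj₁ (away x∈C x∈l) refl)
                          , (λ x∈′ → [ ∈C⇒∉N C∈ x∈C ∘ S⊆
                                     , (λ { (here refl) → v∉R (∈C⇒∈R C∈ x∈C) }) ]′ (∈-++⁻ S x∈′)) ]′ (∈-++⁻ l x∈))
              (λ x∈C q∈ x~q → [ (λ q∈l → ⊥-elim (proj₂ (away x∈C q∈l) x~q))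
                              , (λ q∈′ → [ (λ q∈S → only q∈S (inc⇐ (lose x∈C (~-sym x~q))))
                                         , (λ { (here refl) → ⊥-elim (∈C⇒≁v C∈ x∈C (~-sym x~q)) }) ]′ (∈-++⁻ S q∈′)) ]′ (∈-++⁻ l q∈))) g
          , (λ x∈ → [ ∈-++⁺ˡ ∘ l′⊆ , ∈-++⁺ʳ C ∘ l⊆ ]′ (∈-++⁻ l′ x∈))
          , ≤-trans (+-mono-≤ |l′|≥ ∑≤) (≤-reflexive (≡.sym (length-++ l′))) )

      weigh : ∀ S Gs → (∀ {u} → u ∈ S → u ∈ N) → Unique S → (∀ {C} → C ∈ Gs → C ∈ Cs) → Unique Gs →
              (∀ {C} → C ∈ Gs → HitOnce S C) → length S + ∑ root Gs ≤ a
      weigh S Gs S⊆ S! Gs⊆ Gs! once = decidable-stable (_ ≤? _) λ ≰a →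
        forest S⊆ Gs Gs⊆ Gs! once λ (l , g , l⊆ , ∑≤) → ≰a (begin
          length S + ∑ root Gs   ≡⟨ +-comm (length S) _ ⟩
          ∑ root Gs + length S   ≤⟨ +-monoˡ-≤ (length S) ∑≤ ⟩
          length l + length S    ≡⟨ length-++ l ⟨
          length (l ++ S)        ≤⟨ bounded (Grow-++ g (Grow-star S! (proj₂ ∘ ∈N⇒ ∘ S⊆)))
                                      (λ x∈ → [ (λ x∈l → let D , x∈D , D∈ = ∈-concat⁻′ Gs (l⊆ x∈l) in ∈C⇒∈R (Gs⊆ D∈) x∈D)
                                              , proj₁ ∘ ∈N⇒ ∘ S⊆ ]′ (∈-++⁻ l x∈)) ⟩
          a                      ∎)
        where open ≤-Reasoning

    -- A neighbour of `v` would already exceed the bound; without neighbours, `attached` leaves no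
    -- component.
    step-zero : Bounded v R 0 → R ≡ []
    step-zero bounded = empty λ x∈ →
      [ N-empty , (λ x∈H → let C , x∈C , C∈ = component x∈H in N-empty (proj₁ (proj₂ (attached C∈)))) ]′
      (∈-++⁻ N (∈-resp-↭ (filter-↭-partition (v ~?_) R) x∈))
      where
      N-empty : ∀ {u} → u ∉ N
      N-empty u∈ = <⇒≱ (∈-length u∈) (|N|≤ bounded)
      empty : ∀ {xs : List V} → (∀ {x} → x ∉ xs) → xs ≡ []
      empty {[]}    _   = refl
      empty {x ∷ _} ∉xs = ⊥-elim (∉xs (here refl))

    module Suc {b} (bounded : Bounded v R (suc b)) where

      open Weighing b distinct root-positive hit (weigh bounded)

      ∑tri : ∑ (tri ∘ root) Cs + ∑ (tri ∘ root) Cs ≡ squares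
      ∑tri = ≡.trans (≡.sym (∑-+ _ _ Cs)) (∑-cong Cs (λ {C} _ → tri-double (root C)))

      ∑tri≤ : ∑ (tri ∘ root) Cs ≤ tri b
      ∑tri≤ = *-cancelˡ-≤ 2 (begin
        2 * t          ≡⟨ cong (t +_) (+-identityʳ t) ⟩
        t + t          ≡⟨ ∑tri ⟩
        squares        ≤⟨ squares≤ ⟩
        suc b * b      ≡⟨ *-comm (suc b) b ⟩
        b * suc b      ≡⟨ tri-double b ⟨
        tri b + tri b  ≡⟨ cong (tri b +_) (+-identityʳ (tri b)) ⟨
        2 * tri b      ∎)
        where
        open ≤-Reasoning
        t = ∑ (tri ∘ root) Cs

      ∑length≤∑tri : ∑ length Cs ≤ ∑ (tri ∘ root) Cs
      ∑length≤∑tri = ∑-mono Cs (λ {C} _ → root-upper C)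

      |R|≤tri : length R ≤ tri (suc b)
      |R|≤tri = ≤-trans (≤-reflexive |R|≡) (+-mono-≤ (|N|≤ bounded) (≤-trans ∑length≤∑tri ∑tri≤))

      -- Here `b` is `suc b′`. If `u′` missed `w`, then `u` and `u′` hung on `v`, `w` on `u`, and
      -- the second layer `N₂` on `w` would form a tree with `b′ + 3` vertices besides `v`, one more
      -- than `suc b`.
      same-neighbours : ∀ {C u u′ w} → C ∈ Cs → Unique C → Layered b u C →
                        u ∈ N → u′ ∈ N → w ∈ C → u ~ w → u′ ~ w
      same-neighbours {C} {u} {u′} {w} C∈ C! (layer {b′} {u = u₁} N₁ R₂ C↭ |N₁| u~N₁ u≁R₂ u₁∈ inner same) u∈ u′∈ w∈ u~w
          with firstLayer (Unique-++⁻ʳ N₁ (Unique-resp-↭ C↭ C!)) inner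
      ... | N₂ , N₂! , |N₂| , N₂⊆ , u₁~N₂ = decidable-stable (u′ ~? w) λ u′≁w →
        <⇒≱ (≤-reflexive (≡.sym (long N₂ |N₂|)))
          (bounded {N₂ ++ w ∷ u ∷ u′ ∷ []} (Grow-++
            (Grow-leaves N₂! (here refl) (λ y∈ → ~-sym (N₁~N₂ w∈N₁ y∈))
              (λ { y∈ (here refl) → ~⇒≢ (N₁~N₂ w∈N₁ y∈) refl
                 ; y∈ (there (here refl)) → ∈C⇒∉N C∈ (N₂⊆C y∈) u∈
                 ; y∈ (there (there (here refl))) → ∈C⇒∉N C∈ (N₂⊆C y∈) u′∈
                 ; y∈ (there (there (there (here refl)))) → v∉R (∈C⇒∈R C∈ (N₂⊆C y∈)) })
              (λ { y∈ (here refl) _ → refl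
                 ; y∈ (there (here refl)) y~u → ⊥-elim (u≁R₂ (N₂⊆ y∈) (~-sym y~u))
                 ; y∈ (there (there (here refl))) y~u′ → ⊥-elim (u′≁N₂ y∈ (~-sym y~u′))
                 ; y∈ (there (there (there (here refl)))) y~v → ⊥-elim (∈C⇒≁v C∈ (N₂⊆C y∈) (~-sym y~v)) }))
            (attach
              (Grow-star (((λ { refl → u′≁w u~w }) ∷ []) ∷ [] ∷ [])
                (λ { (here refl) → proj₂ (∈N⇒ u∈) ; (there (here refl)) → proj₂ (∈N⇒ u′∈) }))
              (λ { (here refl) → ∈C⇒∉N C∈ w∈ u∈
                 ; (there (here refl)) → ∈C⇒∉N C∈ w∈ u′∈
                 ; (there (there (here refl))) → v∉R (∈C⇒∈R C∈ w∈) })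
              (here refl) (~-sym u~w)
              (λ { (here refl) _ → refl
                 ; (there (here refl)) w~u′ → ⊥-elim (u′≁w (~-sym w~u′))
                 ; (there (there (here refl))) w~v → ⊥-elim (∈C⇒≁v C∈ w∈ (~-sym w~v)) })))
            (λ y∈ → [ ∈C⇒∈R C∈ ∘ N₂⊆C
                    , (λ { (here refl) → ∈C⇒∈R C∈ w∈
                         ; (there (here refl)) → proj₁ (∈N⇒ u∈)
                         ; (there (there (here refl))) → proj₁ (∈N⇒ u′∈) }) ]′ (∈-++⁻ N₂ y∈)))
        where
        long : ∀ L → length L ≡ b′ → length (L ++ w ∷ u ∷ u′ ∷ []) ≡ suc (suc (suc b′))
        long L refl = ≡.trans (length-++ L) (+-comm (length L) 3)

        ⊆C : ∀ {y} → y ∈ N₁ ++ R₂ → y ∈ C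
        ⊆C = ∈-resp-↭ (↭-sym C↭)

        N₂⊆C : ∀ {y} → y ∈ N₂ → y ∈ C
        N₂⊆C = ⊆C ∘ ∈-++⁺ʳ N₁ ∘ N₂⊆

        w∈N₁ : w ∈ N₁
        w∈N₁ = [ (λ w∈ → w∈) , (λ w∈ → ⊥-elim (u≁R₂ w∈ u~w)) ]′ (∈-++⁻ N₁ (∈-resp-↭ C↭ w∈))

        -- `N₂` is found below the representative `u₁`; `same` transfers its adjacency to all of
        -- `N₁`.
        N₁~N₂ : ∀ {x y} → x ∈ N₁ → y ∈ N₂ → x ~ y
        N₁~N₂ x∈ y∈ = ≡.trans (same x∈ (N₂⊆ y∈)) (u₁~N₂ y∈)

        -- Otherwise `u′` hung on `v`, `y` on `u′` and all of `N₁` on `y` form a tree that is again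
        -- one vertex too large; triangle-freeness keeps `N₁` away from `u′`.
        u′≁N₂ : ∀ {y} → y ∈ N₂ → ¬ u′ ~ y
        u′≁N₂ {y} y∈ u′~y =
          <⇒≱ (≤-reflexive (≡.sym (≡.trans (length-++ N₁) (≡.trans (+-comm (length N₁) 2) (cong (2 +_) |N₁|)))))
            (bounded {N₁ ++ y ∷ u′ ∷ []} (Grow-++
              (Grow-leaves (Unique-++⁻ˡ N₁ (Unique-resp-↭ C↭ C!)) (here refl) (λ x∈ → N₁~N₂ x∈ y∈)
                (λ { x∈ (here refl) → ~⇒≢ (N₁~N₂ x∈ y∈) refl
                   ; x∈ (there (here refl)) → ∈C⇒∉N C∈ (N₁⊆C x∈) u′∈
                   ; x∈ (there (there (here refl))) → v∉R (∈C⇒∈R C∈ (N₁⊆C x∈)) })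
                (λ { x∈ (here refl) _ → refl
                   ; x∈ (there (here refl)) x~u′ → ⊥-elim (no-triangle x~u′ (N₁~N₂ x∈ y∈) u′~y)
                   ; x∈ (there (there (here refl))) x~v → ⊥-elim (∈C⇒≁v C∈ (N₁⊆C x∈) (~-sym x~v)) }))
              (attach
                (Grow-star ([] ∷ []) (λ { (here refl) → proj₂ (∈N⇒ u′∈) }))
                (λ { (here refl) → ∈C⇒∉N C∈ (N₂⊆C y∈) u′∈
                   ; (there (here refl)) → v∉R (∈C⇒∈R C∈ (N₂⊆C y∈)) })
                (here refl) (~-sym u′~y)
                (λ { (here refl) _ → refl
                   ; (there (here refl)) y~v → ⊥-elim (∈C⇒≁v C∈ (N₂⊆C y∈) (~-sym y~v)) })))
              (λ x∈ → [ ∈C⇒∈R C∈ ∘ N₁⊆C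
                      , (λ { (here refl) → ∈C⇒∈R C∈ (N₂⊆C y∈)
                           ; (there (here refl)) → proj₁ (∈N⇒ u′∈) }) ]′ (∈-++⁻ N₁ x∈)))
          where
          N₁⊆C : ∀ {x} → x ∈ N₁ → x ∈ C
          N₁⊆C = ⊆C ∘ ∈-++⁺ˡ

      -- The case of equality in the induction step.

      module Equality (|R|≡tri : length R ≡ tri (suc b)) where

        sizes : length N ≡ suc b × ∑ length Cs ≡ tri b
        sizes = +-tight (|N|≤ bounded) (≤-trans ∑length≤∑tri ∑tri≤) (≤-reflexive (≡.trans (≡.sym |R|≡tri) |R|≡))

        |N|≡ = proj₁ sizes

        some-neighbour : ∃ λ u → u ∈ N
        some-neighbour = inhabitant |N|≡
          where
          inhabitant : ∀ {m} {xs : List V} → length xs ≡ suc m → ∃ λ u → u ∈ xs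
          inhabitant {xs = u ∷ _} _ = u , here refl

        -- No vertices are left for components, so `R` is just `N`. The case is separate because the
        -- hypergraph argument cancels `b`.
        layered-flat : b ≡ 0 → Layered (suc b) v R
        layered-flat refl =
          layer N [] (subst (λ L → R ↭ N ++ L) (length≡0 (≡.trans (length-concat Cs) (proj₂ sizes))) R↭) |N|≡
            (proj₂ ∘ ∈N⇒) (λ ()) (proj₂ some-neighbour) single (λ _ ())
          where
          length≡0 : ∀ {xs : List V} → length xs ≡ 0 → xs ≡ []
          length≡0 {[]} _ = refl

        extremal : suc b * b ≤ squares
        extremal = begin
          suc b * b      ≡⟨ *-comm (suc b) b ⟩
          b * suc b      ≡⟨ tri-double b ⟨
          tri b + tri b  ≤⟨ +-mono-≤ tri≤ tri≤ ⟩
          ∑ (tri ∘ root) Cs + ∑ (tri ∘ root) Cs  ≡⟨ ∑tri ⟩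
          squares        ∎
          where
          open ≤-Reasoning
          tri≤ = ≤-trans (≤-reflexive (≡.sym (proj₂ sizes))) ∑length≤∑tri

        module _ (b≥1 : 1 ≤ b) where

          private
            single-component = Extremal.single-edge (≡-dec _≟_) b≥1 extremal
            C = proj₁ single-component
            Cs≡ = proj₁ (proj₂ single-component)

          C∈ : C ∈ Cs
          C∈ = subst (C ∈_) (≡.sym Cs≡) (here refl)

          C! : Unique C
          C! = case rooted-unique C∈ (proj₂ some-neighbour) of λ { (_ ∷ C!) → C! }

          |C|≡ : length C ≡ tri b
          |C|≡ = begin
            length C       ≡⟨ +-identityʳ _ ⟨
            length C + 0   ≡⟨ cong (∑ length) Cs≡ ⟨
            ∑ length Cs    ≡⟨ proj₂ sizes ⟩
            tri b          ∎
            where open ≡-Reasoning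

          -- A neighbour `u` missing `C`, together with some `w` meeting it, would weigh `2 + b`,
          -- since `C` is hit by `w` alone.
          all-touch : ∀ {u} → u ∈ N → Touches u C
          all-touch {u} u∈ = decidable-stable (touches? u C) λ u≁C →
            let w , w∈ , w~C = attached C∈ in
            <⇒≱ (s≤s (s≤s (≤-reflexive (≡.sym (≡.trans (+-identityʳ _) (proj₂ (proj₂ single-component)))))))
              (weigh bounded (u ∷ w ∷ []) (C ∷ [])
                (λ { (here refl) → u∈ ; (there (here refl)) → w∈ })
                (((λ { refl → u≁C w~C }) ∷ []) ∷ [] ∷ [])
                (λ { (here refl) → C∈ }) ([] ∷ [])
                (λ { (here refl) → w , there (here refl) , inc⇐ w~C ,
                   λ { (here refl) i → ⊥-elim (u≁C (inc⇒ i)) ; (there (here refl)) _ → refl } }))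

          layered-C : ∀ {u} → u ∈ N → Layered b u C
          layered-C {u} u∈ = proj₂ (IH b u C (|C|≤fuel C∈) (rooted-unique C∈ u∈)
            (rooted-conn C∈ (all-touch u∈)) bounded-u) |C|≡
            where
            -- Hanging `u` on `v` adds one vertex to any tree grown from `u` inside `C`, so the
            -- bound drops from `suc b` to `b`.
            bounded-u : Bounded u C b
            bounded-u {l} g l⊆ = s≤s⁻¹ (≤-trans
              (≤-reflexive (≡.trans (+-comm 1 (length l)) (≡.sym (length-++ l))))
              (bounded
                (Grow-++ (Grow-lift g l⊆ (here refl)
                    (λ { x∈ (here refl) → ∈C⇒∉N C∈ x∈ u∈ ; x∈ (there (here refl)) → v∉R (∈C⇒∈R C∈ x∈) })
                    (λ { x∈ (here refl) _ → refl ; x∈ (there (here refl)) x~v → ⊥-elim (∈C⇒≁v C∈ x∈ (~-sym x~v)) }))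
                  (Grow-star ([] ∷ []) (λ { (here refl) → proj₂ (∈N⇒ u∈) })))
                (λ x∈ → [ ∈C⇒∈R C∈ ∘ l⊆ , (λ { (here refl) → proj₁ (∈N⇒ u∈) }) ]′ (∈-++⁻ l x∈))))

          layered : Layered (suc b) v R
          layered =
            let u , u∈ = some-neighbour
                agree = λ {x y w} (x∈ : x ∈ N) (y∈ : y ∈ N) (w∈ : w ∈ C) →
                          same-neighbours {C} {x} {y} {w} C∈ C! (layered-C x∈) x∈ y∈ w∈
            in layer N C (subst (R ↭_) (cong (N ++_) (≡.trans (cong concat Cs≡) (++-identityʳ C))) R↭) |N|≡
                 (proj₂ ∘ ∈N⇒) (∈C⇒≁v C∈) u∈ (layered-C u∈)
                 (λ {x} {w} x∈ w∈ → Bool.⇔→≡ {z = true} (mk⇔ (agree x∈ u∈ w∈) (agree u∈ x∈ w∈)))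

  claim : ∀ fuel → Claim fuel
  claim _ a v [] _ _ _ _ = z≤n , base a
    where
    base : ∀ a → 0 ≡ tri a → Layered a v []
    base zero _ = single
  claim (suc fuel) a v R@(_ ∷ _) |R|≤ vR!@(_ ∷ R!) conn bounded =
    go a bounded (proj₂ (components _ (AllPairs.filter⁺ (∁? (v ~?_)) R!)))
    where
    go : ∀ a → Bounded v R a → ∀ {Cs} → Components (filter (∁? (v ~?_)) R) Cs →
         length R ≤ tri a × (length R ≡ tri a → Layered a v R)
    go zero bounded comps = case Step.step-zero (claim fuel) |R|≤ vR! conn comps bounded of λ ()
    go (suc b) bounded comps = |R|≤tri , λ |R|≡ → case b ≟ℕ 0 of λ
      { (yes b≡0) → Equality.layered-flat |R|≡ b≡0
      ; (no b≢0)  → Equality.layered |R|≡ (n≢0⇒n>0 b≢0) }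
      where open Step.Suc (claim fuel) |R|≤ vR! conn comps bounded

-- Realising grown trees and layerings

module Cycles {m} (G : Graph m) where

  Cyclic : ∀ l → (Fin (3 + l) → Fin m) → Set
  Cyclic l c = (∀ i → Edge G (c (inject₁ i)) (c (suc i))) × Edge G (c (fromℕ (2 + l))) (c zero)

  two-neighbours : ∀ {l c} → Cyclic l c → ∀ i →
    ∃ λ j → ∃ λ k → j ≢ k × Edge G (c i) (c j) × Edge G (c i) (c k)
  two-neighbours {l} {c} (path , closing) zero =
    suc zero , fromℕ (2 + l) , (λ ()) , path zero , ≡.trans (Graph.sym G _ _) closing
  two-neighbours {l} {c} (path , closing) (suc i) = next (view i)
    where
    back : Edge G (c (suc i)) (c (inject₁ i))
    back = ≡.trans (Graph.sym G _ _) (path i)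
    next : ∀ {i} → View i → ∃ λ j → ∃ λ k → j ≢ k × Edge G (c (suc i)) (c j) × Edge G (c (suc i)) (c k)
    next ‵fromℕ = zero , inject₁ (fromℕ (suc l)) , (λ ()) , closing , ≡.trans (Graph.sym G _ _) (path _)
    next (‵inj₁ {i = k} _) = suc (suc k) , inject₁ (inject₁ k)
      , (λ eq → <⇒≢ (m≤n⇒m≤1+n ≤-refl) (≡.sym (≡.trans (cong toℕ eq) (≡.trans (Fin.toℕ-inject₁ _) (Fin.toℕ-inject₁ k)))))
      , path (suc k) , ≡.trans (Graph.sym G _ _) (path (inject₁ k))

module Conclusion {n} (G : Graph n) (triangle-free : TriangleFree G) where
  open Rooted G triangle-free

  Reach-trans : ∀ {m} {K : Graph m} {x y z} → Reach K x y → Reach K y z → Reach K x z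
  Reach-trans here        r = r
  Reach-trans (step e r′) r = step e (Reach-trans r′ r)

  Grow-unique : ∀ {v l} → Grow (v ∷ []) l → Unique (l ++ v ∷ [])
  Grow-unique []                    = [] ∷ []
  Grow-unique (attach g x∉ _ _ _) = All.tabulate (λ y∈ → λ { refl → x∉ y∈ }) ∷ Grow-unique g

  on : (L : List V) → Graph (length L)
  on L = induced G (lookup L)

  Reach-older : ∀ {x L i j} → Reach (on L) i j → Reach (on (x ∷ L)) (suc i) (suc j)
  Reach-older here       = here
  Reach-older (step e r) = step e (Reach-older r)

  Grow-connected : ∀ {v l} → Grow (v ∷ []) l → Connected (on (l ++ v ∷ []))
  Grow-connected [] zero zero = here
  Grow-connected (attach {x} {p} {l} g _ p∈ x~p _) = connected
    where
    L = l ++ _ ∷ []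
    x~index : x ~ lookup L (index p∈)
    x~index = subst (x ~_) (lookup-index p∈) x~p
    connected : Connected (on (x ∷ L))
    connected zero    zero    = here
    connected zero    (suc j) = step x~index (Reach-older (Grow-connected g (index p∈) j))
    connected (suc i) zero    =
      Reach-trans (Reach-older (Grow-connected g i (index p∈))) (step (~-sym x~index) here)
    connected (suc i) (suc j) = Reach-older (Grow-connected g i j)

  -- A cycle through the newest vertex would give it two older neighbours.
  Grow-acyclic : ∀ {v l} → Grow (v ∷ []) l → ¬ HasCycle (on (l ++ v ∷ []))
  Grow-acyclic [] (l , c , inj , _) = case inj {zero} {suc zero} (only (c zero) (c (suc zero))) of λ ()
    where
    only : (i j : Fin 1) → i ≡ j
    only zero zero = refl
  Grow-acyclic {v} (attach {x} {p} {l} g _ _ _ unique) (m , c , inj , cyc)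
    with Fin.any? (λ i → c i ≟ zero)
  ... | yes (i , ci≡0) =
    let j , k , j≢k , e , e′ = Cycles.two-neighbours (on (x ∷ L)) {c = c} cyc i
    in j≢k (inj (same (subst (λ t → Edge (on (x ∷ L)) t (c j)) ci≡0 e)
                      (subst (λ t → Edge (on (x ∷ L)) t (c k)) ci≡0 e′)))
    where
    L = l ++ v ∷ []
    same : ∀ {s t} → Edge (on (x ∷ L)) zero s → Edge (on (x ∷ L)) zero t → s ≡ t
    same {zero}          e _ = ⊥-elim (~⇒≢ e refl)
    same {suc _} {zero}  _ e = ⊥-elim (~⇒≢ e refl)
    same {suc s} {suc t} e e′ = cong suc (lookup-injective (Grow-unique g)
      (≡.trans (unique (∈-lookup s) e) (≡.sym (unique (∈-lookup t) e′))))
  ... | no avoids = Grow-acyclic g (m , older , (λ eq → inj (≡.trans (≡.sym (c≡ _)) (≡.trans (cong suc eq) (c≡ _))))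
      , (λ i → edge (c≡ (inject₁ i)) (c≡ (suc i)) (proj₁ cyc i))
      , edge (c≡ _) (c≡ zero) (proj₂ cyc))
    where
    L = l ++ v ∷ []
    pred : ∀ {i : Fin (suc (length L))} → i ≢ zero → ∃ λ j → suc j ≡ i
    pred {zero}  i≢0 = ⊥-elim (i≢0 refl)
    pred {suc j} _   = j , refl
    older : Fin (3 + m) → Fin (length L)
    older i = proj₁ (pred (λ ci≡0 → avoids (i , ci≡0)))
    c≡ : ∀ i → suc (older i) ≡ c i
    c≡ i = proj₂ (pred (λ ci≡0 → avoids (i , ci≡0)))
    edge : ∀ {i j s t} → suc i ≡ s → suc j ≡ t → Edge (on (x ∷ L)) s t → Edge (on L) i j
    edge refl refl e = e

  -- Dropping the newest vertices keeps a grown tree, so a tree that is too large contains one of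
  -- the exact size in `HasInducedTreeThrough`.
  truncate : ∀ {v l} m → m ≤ length l → Grow (v ∷ []) l → ∃ λ l′ → Grow (v ∷ []) l′ × length l′ ≡ m
  truncate {l = l} m m≤ g with m≤n⇒m<n∨m≡n m≤
  ... | inj₂ m≡ = l , g , ≡.sym m≡
  truncate m _ (attach g _ _ _ _) | inj₁ m< = truncate m (s≤s⁻¹ m<) g

  Grow⇒tree : ∀ {v l} m → m ≤ length l → Grow (v ∷ []) l → HasInducedTreeThrough G v (suc m)
  Grow⇒tree {v} m m≤ g = let l , g′ , |l|≡ = truncate m m≤ g in
    subst (HasInducedTreeThrough G v)
      (≡.trans (length-++ l) (≡.trans (+-comm (length l) 1) (cong suc |l|≡)))
      ( lookup (l ++ v ∷ []) , lookup-injective (Grow-unique g′)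
      , (index (v∈ l) , ≡.sym (lookup-index (v∈ l)))
      , Grow-connected g′ , Grow-acyclic g′ )
    where
    v∈ : ∀ l → v ∈ l ++ v ∷ []
    v∈ l = ∈-++⁺ʳ l (here refl)

  Reach⇒constant : ∀ (χ : V → Bool) → (∀ {x y} → x ~ y → χ x ≡ χ y) → ∀ {x y} → Reach G x y → χ x ≡ χ y
  Reach⇒constant χ mono here       = refl
  Reach⇒constant χ mono (step e r) = ≡.trans (mono e) (Reach⇒constant χ mono r)

  -- Layered vertex sets as copies of `GkV`.

  place : ∀ {a v R} → Layered a v R → GkV (suc a) → V
  place {v = v} _ (zero , _) = v
  place (layer N _ _ |N| _ _ _ _ _) (suc zero , j) = lookup N (Fin.cast (≡.sym |N|) j)
  -- The recursion never asks `inner` for its root `u`, which already has its place in `N`.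
  place (layer _ _ _ _ _ _ _ inner _) (suc (suc i) , j) = place inner (suc i , j)

  place-deep : ∀ {a v R} (L : Layered a v R) i j → place L (suc i , j) ∈ R
  place-deep (layer N _ R↭ |N| _ _ _ _ _) zero j =
    ∈-resp-↭ (↭-sym R↭) (∈-++⁺ˡ (∈-lookup {xs = N} (Fin.cast (≡.sym |N|) j)))
  place-deep (layer N _ R↭ _ _ _ _ inner _) (suc i) j =
    ∈-resp-↭ (↭-sym R↭) (∈-++⁺ʳ N (place-deep inner i j))

  place-deep-onto : ∀ {a v R} (L : Layered a v R) {x} → x ∈ R → ∃ λ i → ∃ λ j → place L (suc i , j) ≡ x
  place-deep-onto (layer N R′ R↭ |N| _ _ _ inner _) {x} x∈ with ∈-++⁻ N (∈-resp-↭ R↭ x∈)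
  ... | inj₁ x∈N = zero , Fin.cast |N| (index x∈N)
      , ≡.trans (cong (lookup N) (Fin.cast-involutive (≡.sym |N|) |N| (index x∈N))) (≡.sym (lookup-index x∈N))
  ... | inj₂ x∈R′ = let i , j , eq = place-deep-onto inner x∈R′ in suc i , j , eq

  place-onto : ∀ {a v R} (L : Layered a v R) {x} → x ∈ v ∷ R → ∃ λ p → place L p ≡ x
  place-onto L (here refl) = (zero , zero) , refl
  place-onto L (there x∈)  = let i , j , eq = place-deep-onto L x∈ in (suc i , j) , eq

  place-deep-injective : ∀ {a v R} (L : Layered a v R) → Unique R → ∀ i j i′ j′ →
    place L (suc i , j) ≡ place L (suc i′ , j′) → _≡_ {A = GkV (suc a)} (suc i , j) (suc i′ , j′)
  place-deep-injective (layer N _ R↭ |N| _ _ _ _ _) R! zero j zero j′ eq =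
    cong (suc zero ,_) (begin
      j                                        ≡⟨ Fin.cast-involutive |N| (≡.sym |N|) j ⟨
      Fin.cast |N| (Fin.cast (≡.sym |N|) j)    ≡⟨ cong (Fin.cast |N|) (lookup-injective (Unique-++⁻ˡ N (Unique-resp-↭ R↭ R!)) eq) ⟩
      Fin.cast |N| (Fin.cast (≡.sym |N|) j′)   ≡⟨ Fin.cast-involutive |N| (≡.sym |N|) j′ ⟩
      j′                                       ∎)
    where open ≡-Reasoning
  place-deep-injective (layer N R′ R↭ |N| _ _ _ inner _) R! zero j (suc i′) j′ eq =
    ⊥-elim (Unique-++-disjoint N (Unique-resp-↭ R↭ R!) (∈-lookup {xs = N} _)
             (subst (_∈ R′) (≡.sym eq) (place-deep inner i′ j′)))
  place-deep-injective (layer N R′ R↭ |N| _ _ _ inner _) R! (suc i) j zero j′ eq =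
    ⊥-elim (Unique-++-disjoint N (Unique-resp-↭ R↭ R!) (∈-lookup {xs = N} _)
             (subst (_∈ R′) eq (place-deep inner i j)))
  place-deep-injective (layer N _ R↭ _ _ _ _ inner _) R! (suc i) j (suc i′) j′ eq
    with place-deep-injective inner (Unique-++⁻ʳ N (Unique-resp-↭ R↭ R!)) i j i′ j′ eq
  ... | refl = refl

  place-injective : ∀ {a v R} (L : Layered a v R) → Unique (v ∷ R) → Injective _≡_ _≡_ (place L)
  place-injective L _        {zero , zero} {zero , zero} _ = refl
  place-injective L (v∉ ∷ _) {zero , _}  {suc i , j} eq = ⊥-elim (All.lookup v∉ (place-deep L i j) eq)
  place-injective L (v∉ ∷ _) {suc i , j} {zero , _}  eq = ⊥-elim (All.lookup v∉ (place-deep L i j) (≡.sym eq))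
  place-injective L (_ ∷ R!) {suc i , j} {suc i′ , j′} eq = place-deep-injective L R! i j i′ j′ eq

  Faithful : ∀ {a v R} → Layered a v R → GkV (suc a) → GkV (suc a) → Set
  Faithful L p q = (place L p ~ place L q → GkAdj p q) × (GkAdj p q → place L p ~ place L q)

  Faithful-sym : ∀ {a v R} (L : Layered a v R) p q → Faithful L p q → Faithful L q p
  Faithful-sym L _ _ (to , from) = swap⊎ ∘ to ∘ ~-sym , ~-sym ∘ from ∘ swap⊎

  GkAdj-suc⁺ : ∀ {i j : ℕ} → (j ≡ suc i) ⊎ (i ≡ suc j) → (suc j ≡ suc (suc i)) ⊎ (suc i ≡ suc (suc j))
  GkAdj-suc⁺ = map⊎ (cong suc) (cong suc)

  GkAdj-suc⁻ : ∀ {i j : ℕ} → (suc j ≡ suc (suc i)) ⊎ (suc i ≡ suc (suc j)) → (j ≡ suc i) ⊎ (i ≡ suc j)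
  GkAdj-suc⁻ = map⊎ suc-injective suc-injective

  root-faithful : ∀ {a v R} (L : Layered a v R) i j → Faithful L (zero , zero) (suc i , j)
  root-faithful (layer N _ _ |N| v~N _ _ _ _) zero j =
    (λ _ → inj₁ refl) , λ _ → v~N (∈-lookup {xs = N} (Fin.cast (≡.sym |N|) j))
  root-faithful (layer _ _ _ _ _ v≁R′ _ inner _) (suc i) j =
    (λ e → ⊥-elim (v≁R′ (place-deep inner i j) e)) , λ { (inj₁ ()) ; (inj₂ ()) }

  -- Inside the first layer triangle-freeness excludes edges. Between it and deeper layers, `same`
  -- replaces the vertex by the representative, the root of `inner`, so `root-faithful` applies.
  deep-faithful : ∀ {a v R} (L : Layered a v R) i j i′ j′ → Faithful L (suc i , j) (suc i′ , j′)
  deep-faithful (layer N _ _ _ v~N _ _ _ _) zero _ zero _ =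
    (λ e → ⊥-elim (no-triangle (v~N (∈-lookup {xs = N} _)) (v~N (∈-lookup {xs = N} _)) e)) , λ { (inj₁ ()) ; (inj₂ ()) }
  deep-faithful (layer N _ _ _ _ _ _ inner same) zero _ (suc i′) j′ =
    let to , from = root-faithful inner i′ j′
        eq = same (∈-lookup {xs = N} _) (place-deep inner i′ j′)
    in GkAdj-suc⁺ ∘ to ∘ ≡.trans (≡.sym eq) , ≡.trans eq ∘ from ∘ GkAdj-suc⁻
  deep-faithful L@(layer N _ _ _ _ _ _ inner same) (suc i) j zero j′ =
    let to , from = root-faithful inner i j
        eq = same (∈-lookup {xs = N} _) (place-deep inner i j)
    in Faithful-sym L (suc zero , j′) (suc (suc i) , j)
         (GkAdj-suc⁺ ∘ to ∘ ≡.trans (≡.sym eq) , ≡.trans eq ∘ from ∘ GkAdj-suc⁻)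
  deep-faithful (layer _ _ _ _ _ _ _ inner _) (suc i) j (suc i′) j′ =
    let to , from = deep-faithful inner i j i′ j′ in GkAdj-suc⁺ ∘ to , from ∘ GkAdj-suc⁻

  place-faithful : ∀ {a v R} (L : Layered a v R) p q → Faithful L p q
  place-faithful L (zero , _) (zero , _) = (λ e → ⊥-elim (~⇒≢ e refl)) , λ { (inj₁ ()) ; (inj₂ ()) }
  place-faithful L (zero , zero) (suc i , j) = root-faithful L i j
  place-faithful L (suc i , j) (zero , zero) = Faithful-sym L (zero , zero) (suc i , j) (root-faithful L i j)
  place-faithful L (suc i , j) (suc i′ , j′) = deep-faithful L i j i′ j′

  Layered⇒Iso : ∀ {a v R} → Unique (v ∷ R) → (∀ x → x ∈ v ∷ R) → Layered a v R → ∀ k≥1 → IsoToGk G v (suc a) k≥1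
  Layered⇒Iso {a} {v} {R} vR! all L k≥1 =
      ↔-sym placing
    , (λ x y → let to , from = place-faithful L (Inverse.from placing x) (Inverse.from placing y) in
         to ∘ subst₂ _~_ (≡.sym (placed x)) (≡.sym (placed y)) , subst₂ _~_ (placed x) (placed y) ∘ from)
    , place-injective L vR! (placed v)
    where
    placing : GkV (suc a) ↔ V
    placing = ⤖⇒↔ (mk⤖ {to = place L} (place-injective L vR! ,
                (λ x → let p , eq = place-onto L (all x) in p , λ { refl → eq })))
    placed : ∀ x → place L (Inverse.from placing x) ≡ x
    placed = Inverse.strictlyInverseˡ placing

-- From rooted vertex lists to the whole graph.

theorem1 : (k : ℕ) (k≥1 : 1 ≤ k) (n : ℕ) (G : Graph n) (v : Fin n) →
    Connected G → TriangleFree G → ¬ HasInducedTreeThrough G v (suc k) →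
    (n ≤ 1 + ((k ∸ 1) * k) / 2)
    × (n ≡ 1 + ((k ∸ 1) * k) / 2 → IsoToGk G v k k≥1)
theorem1 (suc a) k≥1 n G v connected triangle-free no-tree =
    ≤-trans (≤-reflexive n≡) (s≤s (≤-trans (proj₁ result) (≤-reflexive (≡.sym half))))
  , λ n≡bound → Layered⇒Iso vR! all
      (proj₂ result (suc-injective (≡.trans (≡.sym n≡) (≡.trans n≡bound (cong suc half))))) k≥1
  where
  open Conclusion G triangle-free
  open Rooted G triangle-free

  R : List V
  R = filter (∁? (_≟ v)) (allFin n)

  allFin↭ : allFin n ↭ v ∷ R
  allFin↭ = ↭-trans (filter-↭-partition (_≟ v) (allFin n)) (↭-reflexive (cong (_++ R)
    (Unique-const⇒singleton (Unique.filter⁺ (_≟ v) (Unique.allFin⁺ n)) (∈-filter⁺ (_≟ v) (∈-allFin v) refl)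
      (λ x∈ → proj₂ (∈-filter⁻ (_≟ v) {xs = allFin n} x∈)))))

  vR! : Unique (v ∷ R)
  vR! = Unique-resp-↭ allFin↭ (Unique.allFin⁺ n)

  all : ∀ x → x ∈ v ∷ R
  all x = ∈-resp-↭ allFin↭ (∈-allFin x)

  n≡ : n ≡ suc (length R)
  n≡ = ≡.trans (≡.sym (length-tabulate (λ i → i))) (↭-length allFin↭)

  half : (a * suc a) / 2 ≡ tri a
  half = ≡.trans (cong (_/ 2) (begin
      a * suc a            ≡⟨ tri-double a ⟨
      tri a + tri a        ≡⟨ cong (tri a +_) (+-identityʳ (tri a)) ⟨
      2 * tri a            ≡⟨ *-comm 2 (tri a) ⟩
      tri a * 2            ∎)) (m*n/n≡m (tri a) 2)
    where open ≡-Reasoning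

  result : length R ≤ tri a × (length R ≡ tri a → Layered a v R)
  result = claim (length R) a v R ≤-refl vR!
    (λ χ mono {x} {y} _ _ → Reach⇒constant χ (λ {s} {t} → mono (all s) (all t)) (connected x y))
    -- A tree with more than `a` vertices besides `v` is cut back to `suc a` of them; with `v` these
    -- are `suc k`, as `k` is `suc a`.
    (λ g _ → ≮⇒≥ (λ a<|l| → no-tree (Grow⇒tree (suc a) a<|l| g)))
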